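{- There is a representation (data structure) of Z-groups such that, for every finite Z-group $G$ of order $n$, the multiplication operation can be performed using $\mathcal{O}(n)$ space (words) in $\mathcal{O}(1)$ time. The constants in the $\mathcal{O}$-notation are absolute.
   Context: A Z-group is a finite group all of whose Sylow subgroups are cyclic. Model of computation: word RAM with constant-time random access. For a group of order $n$, each register and memory unit (word) stores $\mathcal{O}(\log n)$ bits, and arithmetic, logic and comparison operations on words of $\mathcal{O}(\log n)$ bits take constant time. The elements of the group are encoded as $1,2,\ldots,n$. A representation of a group $G$ is a data structure stored in memory, produced in a preprocessing phase from $G$ and its Cayley table; preprocessing may use any finite amount of time and space, and this is not counted. The space of the representation is the number of words the data structure occupies. A multiplication query is given two elements $x,y\in G$ and must return $z=xy$; the query time is the worst-case time to answer such a query using the data structure. -}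

module Defs where

open import Algebra.Bundles using (Group)
open import Algebra.Structures using (IsGroup)
open import Algebra.Definitions.RawMonoid using () renaming (_×_ to power)
open import Data.Bool.Base using (Bool; if_then_else_; _∧_; _∨_; _xor_)
open import Data.Fin.Base using (Fin; toℕ; fromℕ<)
open import Data.Fin.Subset using (Subset; _∈_; ∣_∣)
open import Data.Integer.Base using (ℤ; +_; -[1+_])
open import Data.List.Base using (List; []; _∷_)
open import Data.Maybe.Base using (Maybe; just; nothing; _>>=_)
open import Data.Nat.Base using (ℕ; zero; suc; NonZero; _+_; _*_; _∸_; _^_; _≡ᵇ_; _<ᵇ_)
open import Data.Nat.Divisibility using (_∣_)
open import Data.Nat.DivMod using (_/_; _%_; _mod_)
open import Data.Nat.Logarithm using (⌊log₂_⌋)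
open import Data.Nat.Primality using (Prime)
open import Data.Nat.Properties using (m^n≢0; _<?_)
open import Data.Product.Base using (∃-syntax; _×_)
open import Data.Vec.Base using (Vec; _∷_; head; lookup; replicate; _[_]≔_)
open import Level using (0ℓ)
open import Relation.Binary.PropositionalEquality.Core using (_≡_)
open import Relation.Nullary.Decidable.Core using (yes; no)
open import Relation.Nullary.Negation.Core using (¬_)

-- A group of order n whose elements are already encoded; _∙_ is an arbitrary
-- Cayley table, so every encoding of every group of order n is of this form.
record FiniteGroup (n : ℕ) : Set where
  infixl 7 _∙_
  field
    _∙_     : Fin n → Fin n → Fin n
    ε       : Fin n
    _⁻¹     : Fin n → Fin n
    isGroup : IsGroup _≡_ _∙_ ε _⁻¹

  group : Group 0ℓ 0ℓ
  group = record { isGroup = isGroup }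

  open Group group public using (rawMonoid)

  _^ᶻ_ : Fin n → ℤ → Fin n
  x ^ᶻ (+ k)    = power rawMonoid k x
  x ^ᶻ -[1+ k ] = (power rawMonoid (suc k) x) ⁻¹

module _ {n : ℕ} (G : FiniteGroup n) where
  open FiniteGroup G

  record IsSubgroup (H : Subset n) : Set where
    field
      ∙-closed  : ∀ {x y} → x ∈ H → y ∈ H → x ∙ y ∈ H
      ε-closed  : ε ∈ H
      ⁻¹-closed : ∀ {x} → x ∈ H → x ⁻¹ ∈ H

  -- The order of H is the largest power of p dividing the order of G.
  record IsSylow (p : ℕ) (H : Subset n) : Set where
    field
      isSubgroup : IsSubgroup H
      exponent   : ℕ
      order      : ∣ H ∣ ≡ p ^ exponent
      divides    : p ^ exponent ∣ n
      maximal    : ¬ (p ^ suc exponent ∣ n)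

  IsCyclic : Subset n → Set
  IsCyclic H = ∃[ g ] (g ∈ H × (∀ x → x ∈ H → ∃[ k ] x ≡ g ^ᶻ k))

  IsZGroup : Set
  IsZGroup = ∀ p → Prime p → ∀ H → IsSylow p H → IsCyclic H

data Operation : Set where
  add sub mul quo rem : Operation
  and or xor shl shr  : Operation
  eq lt               : Operation

-- Instructions of a machine with r registers. Register operands are
-- immediate; a destination always comes first. Jump targets are absolute.
data Instruction (r : ℕ) : Set where
  const : Fin r → ℕ → Instruction r
  copy  : Fin r → Fin r → Instruction r
  op    : Operation → Fin r → Fin r → Fin r → Instruction r
  load  : (dst addr : Fin r) → Instruction r
  store : (addr src : Fin r) → Instruction r
  jump  : ℕ → Instruction r
  jumpz : Fin r → ℕ → Instruction r
  halt  : Instruction r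

Program : ℕ → Set
Program r = List (Instruction r)

fetch : ∀ {r} → Program r → ℕ → Maybe (Instruction r)
fetch []      _       = nothing
fetch (i ∷ _) zero    = just i
fetch (_ ∷ P) (suc k) = fetch P k

bit : Bool → ℕ
bit b = if b then 1 else 0

-- Applies f to each of the w least significant bits.
bitwise : (Bool → Bool → Bool) → ℕ → ℕ → ℕ → ℕ
bitwise f zero    a b = 0
bitwise f (suc w) a b =
  bit (f (a % 2 ≡ᵇ 1) (b % 2 ≡ᵇ 1)) + 2 * bitwise f w (a / 2) (b / 2)

-- The machine with w-bit words; `nothing` is a fault.
module Machine (w : ℕ) where

  instance
    2^w≢0 : NonZero (2 ^ w)
    2^w≢0 = m^n≢0 2 w

  Word : Set
  Word = Fin (2 ^ w)

  word : ℕ → Word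
  word a = a mod (2 ^ w)

  evalℕ : Operation → ℕ → ℕ → Maybe ℕ
  evalℕ add a b       = just (a + b)
  evalℕ sub a b       = just (a + (2 ^ w ∸ b))
  evalℕ mul a b       = just (a * b)
  evalℕ quo a zero    = nothing
  evalℕ quo a (suc b) = just (a / suc b)
  evalℕ rem a zero    = nothing
  evalℕ rem a (suc b) = just (a % suc b)
  evalℕ and a b       = just (bitwise _∧_ w a b)
  evalℕ or  a b       = just (bitwise _∨_ w a b)
  evalℕ xor a b       = just (bitwise _xor_ w a b)
  evalℕ shl a b       = just (a * 2 ^ b)
  evalℕ shr a b       = just ((a / 2 ^ b) {{m^n≢0 2 b}})
  evalℕ eq  a b       = just (bit (a ≡ᵇ b))
  evalℕ lt  a b       = just (bit (a <ᵇ b))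

  eval : Operation → Word → Word → Maybe Word
  eval o a b = evalℕ o (toℕ a) (toℕ b) >>= λ c → just (word c)

  -- The memory consists of exactly s words, at addresses 0, …, s - 1.
  record State (r s : ℕ) : Set where
    constructor state
    field
      pc        : ℕ
      registers : Vec Word r
      memory    : Vec Word s

  address : (s : ℕ) → Word → Maybe (Fin s)
  address s a with toℕ a <? s
  ... | yes a<s = just (fromℕ< a<s)
  ... | no  _   = nothing

  -- The effect of an instruction other than `halt`, which `run` intercepts.
  exec : ∀ {r s} → Instruction r → State r s → Maybe (State r s)
  exec (const d v) (state pc R M) =
    just (state (suc pc) (R [ d ]≔ word v) M)
  exec (copy d a) (state pc R M) =
    just (state (suc pc) (R [ d ]≔ lookup R a) M)
  exec (op o d a b) (state pc R M) =
    eval o (lookup R a) (lookup R b) >>= λ c →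
    just (state (suc pc) (R [ d ]≔ c) M)
  exec {s = s} (load d a) (state pc R M) =
    address s (lookup R a) >>= λ i →
    just (state (suc pc) (R [ d ]≔ lookup M i) M)
  exec {s = s} (store a b) (state pc R M) =
    address s (lookup R a) >>= λ i →
    just (state (suc pc) R (M [ i ]≔ lookup R b))
  exec (jump l) (state pc R M) = just (state l R M)
  exec (jumpz a l) (state pc R M) with toℕ (lookup R a)
  ... | zero  = just (state l R M)
  ... | suc _ = just (state (suc pc) R M)
  exec halt S = just S

  -- The final state, if P halts without a fault after at most t unit-cost
  -- instructions.
  run : ∀ {r s} → ℕ → Program r → State r s → Maybe (State r s)
  run zero    P S = nothing
  run (suc t) P S with fetch P (State.pc S)
  ... | nothing   = nothing
  ... | just halt = just S
  ... | just i    = exec i S >>= run t P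

-- Group elements are presented to the machine as 1, …, n.
label : ∀ {n} → Fin n → ℕ
label x = suc (toℕ x)

-- The summand 1 makes the bound meaningful for n = 1, and lets all labels fit
-- into a word as soon as c ≥ 1.
wordSize : (c n : ℕ) → ℕ
wordSize c n = c * suc ⌊log₂ n ⌋

-- A representation of the class C of finite groups. The program, its registers
-- and the constant in the word size do not depend on the group; only the
-- contents of the memory do.
record Representation (C : ∀ {n} → FiniteGroup n → Set) : Set where
  field
    wordFactor     : ℕ
    extraRegisters : ℕ
    program        : Program (2 + extraRegisters)

  width : ℕ → ℕ
  width n = wordSize wordFactor n

  open Machine

  field
    space      : ∀ {n} (G : FiniteGroup n) → C G → ℕ
    preprocess : ∀ {n} (G : FiniteGroup n) (G∈C : C G) →
                 Vec (Word (width n)) (space G G∈C)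

  -- Operands arrive in the first two registers.
  query : ∀ {n} (G : FiniteGroup n) (G∈C : C G) → Fin n → Fin n →
          State (width n) (2 + extraRegisters) (space G G∈C)
  query {n} G G∈C x y = state 0
    (word (width n) (label x) ∷ word (width n) (label y) ∷
     replicate extraRegisters (word (width n) 0))
    (preprocess G G∈C)

  -- The product is returned in the first register, and the data structure is
  -- left intact for later queries.
  MultipliesWithin : ℕ → ∀ {n} (G : FiniteGroup n) → C G → Set
  MultipliesWithin t {n} G G∈C = ∀ x y → ∃[ S ]
    ( run (width n) t program (query G G∈C x y) ≡ just S
    × toℕ (head (State.registers S)) ≡ label (FiniteGroup._∙_ G x y)
    × State.memory S ≡ preprocess G G∈C )

{-# OPTIONS --safe #-}
module Submission where

-- A Z-group G of order n has a cyclic normal subgroup ⟨ c ⟩ which is its own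
-- centralizer. The conjugates of c lie in ⟨ c ⟩, so G has at most ∣⟨ c ⟩∣ cosets of
-- ⟨ c ⟩, say with representatives t 0, …, t (k - 1), where k * k ≤ n. Writing x as
-- t i ∙ c ↑ u and y as t j ∙ c ↑ v, the product x ∙ y is found with tables for the
-- products c ↑ u ∙ t j and t i ∙ t j, which have n and k * k ≤ n entries.
--
-- The subgroup is built along a chain of divisors d of n, each obtained from the
-- next by removing its smallest prime factor p. Counting shows that x ↑ d ≡ ε has
-- exactly d solutions. If this holds for d = p * d′ then the number of solutions
-- for d′ is k * d′ for some k with 1 ≤ k < p, by a special case of Frobenius' theorem
-- and as a Sylow p-subgroup is cyclic; moreover p - 1 divides the number (p - k) * d′
-- of the other solutions, since the generators of cyclic subgroups of order p ^ b
-- come in families of p ^ (b - 1) * (p - 1). So k ≡ 1. Upwards along the chain, the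
-- solutions for d form a subgroup containing the one for d′ with index p, and a
-- self-centralizing c′ for d′ yields one for d: if its centralizer grows, it does so
-- by an element of p-power order, which replaces the p-part of c′.

open import Defs
open import Algebra.Bundles using (Group)
open import Algebra.Definitions.RawMonoid using () renaming (_×_ to power)
import Algebra.Properties.Group as GroupProperties
import Algebra.Properties.Monoid.Mult as Mult
open import Data.Bool.Base using (if_then_else_)
open import Data.Empty using (⊥)
open import Data.Fin.Base as Fin using (Fin; zero; suc; toℕ; fromℕ<)
open import Data.Fin.Patterns
open import Data.Fin.Properties as Fin using (all?; any?; toℕ-injective; pigeonhole; toℕ<n; toℕ-fromℕ<) renaming (_≟_ to _≟ᶠ_; _≤?_ to _≤ᶠ?_)
open import Data.Fin.Subset using (∣_∣; inside) renaming (_∈_ to _∈ˢ_)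
import Data.Integer.Base as ℤ
open import Data.List.Base using ([]; _∷_)
open import Data.Maybe.Base using (Maybe; just; _>>=_)
open import Data.Nat.Base
open import Data.Nat.Coprimality using (Coprime; coprime-Bézout; coprime-divisor) renaming (sym to coprime-sym)
open import Data.Nat.Divisibility
open import Data.Nat.DivMod using (m≡m%n+[m/n]*n; m<n⇒m%n≡m; m%n<n; m%n≤m; m<n⇒m/n≡0; m*n/n≡m; +-distrib-/-∣ʳ; [m+kn]%n≡m%n)
open import Data.Nat.GCD using (module Bézout)
open import Data.Nat.Induction using (<-rec)
open import Data.Nat.Logarithm using (⌊log₂_⌋; ⌊log₂⌋-mono-≤; ⌊log₂[2^n]⌋≡n)
open import Data.Nat.Primality
open import Data.Nat.Properties
open import Data.Nat.Solver using (module +-*-Solver)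
open import Data.Product.Base
open import Data.Sum.Base using (inj₁; inj₂)
open import Data.Unit.Base using (⊤)
open import Data.Vec.Base as Vec using (Vec; []; _∷_; lookup; tabulate; replicate; _[_]≔_)
open import Data.Vec.Properties using (lookup∘tabulate; []=⇒lookup; lookup⇒[]=)
open import Function.Base using (_∘_; id)
open import Relation.Binary.Definitions using (tri<; tri≈; tri>)
open import Relation.Binary.PropositionalEquality
open import Relation.Nullary using (¬_; Dec; yes; no; does; contradiction)
open import Relation.Nullary.Decidable using (True; toWitness; _×-dec_; _→-dec_; ¬?)

import Algebra.Properties.Semiring.Sum +-*-semiring as Sum

-- The usual route to the structure of Z-groups uses transfer and complements; counting replaces
-- both, and no quotient group is ever formed. Primes are removed in increasing order for two
-- reasons. Every prime factor of `p - 1` is smaller than every prime factor of `d′`, so a divisor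
-- `p - 1` of `(p - k) * d′` divides `p - k`. And `d′` contains the full power in `n` of each of its
-- prime factors other than `p`, so Frobenius' theorem is needed for full prime powers only, where
-- an induction over centralizers proves it; at `p` itself the count of generators gives the
-- divisibility. Normality of `⟨ c ⟩` serves in the end to bound the number of cosets. The tables
-- rest on the coset decomposition alone: if `c ↑ u ∙ t j` is `t i′ ∙ c ↑ u′` and `t i ∙ t i′` is
-- `t i″ ∙ c ↑ u″`, then the product is `t i″ ∙ c ↑ (u″ + u′ + v)`, and a third table turns these
-- coordinates back into an element.

-- Elementary number theory

least : (P : ℕ → Set) → (∀ k → Dec (P k)) → ∀ {k} → P k →
        ∃[ j ] (P j × (∀ {i} → i < j → ¬ P i))
least P P? {k} Pk with P? 0
... | yes P0 = 0 , P0 , λ ()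
least P P? {zero}  Pk | no ¬P0 = contradiction Pk ¬P0
least P P? {suc k} Pk | no ¬P0 with least (λ i → P (suc i)) (λ i → P? (suc i)) Pk
... | j , Pj , min = suc j , Pj ,
  λ { {zero} _ → ¬P0 ; {suc i} (s≤s i<j) → min i<j }

prime>1 : ∀ {p} → Prime p → 1 < p
prime>1 pp = nonTrivial⇒n>1 _ {{prime⇒nonTrivial pp}}

∣⇒>0 : ∀ {m n} → m ∣ n → 0 < n → 0 < m
∣⇒>0 {zero}  m∣n 0<n = contradiction (0∣⇒≡0 m∣n) (>⇒≢ 0<n)
∣⇒>0 {suc m} m∣n 0<n = z<s

least-prime-factor : ∀ {d} → 1 < d →
  ∃[ p ] (Prime p × p ∣ d × (∀ {q} → Prime q → q ∣ d → p ≤ q))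
least-prime-factor {d} 1<d
  with least (λ k → 1 < k × k ∣ d) (λ k → (1 <? k) ×-dec (k ∣? d)) (1<d , ∣-refl)
... | p , (1<p , p∣d) , min = p , prime-p , p∣d ,
  λ {q} pq q∣d → ≮⇒≥ λ q<p → min q<p (prime>1 pq , q∣d)
  where
  instance
    p-nt : NonTrivial p
    p-nt = n>1⇒nonTrivial 1<p
  prime-p : Prime p
  prime-p = irreducible⇒prime irr
    where
    irr : Irreducible p
    irr {zero} e∣p = contradiction (0∣⇒≡0 e∣p) (>⇒≢ (<-trans z<s 1<p))
    irr {suc zero} e∣p = inj₁ refl
    irr {e@(suc (suc _))} e∣p with m≤n⇒m<n∨m≡n (∣⇒≤ {{>-nonZero (<-trans z<s 1<p)}} e∣p)
    ... | inj₂ e≡p = inj₂ e≡p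
    ... | inj₁ e<p = contradiction (s≤s z<s , ∣-trans e∣p p∣d) (min e<p)

prime-∤⇒coprime : ∀ {p m} → Prime p → ¬ p ∣ m → Coprime p m
prime-∤⇒coprime pp p∤m (d∣p , d∣m) with prime⇒irreducible pp d∣p
... | inj₁ d≡1 = d≡1
... | inj₂ d≡p = contradiction (subst (_∣ _) d≡p d∣m) p∤m

coprime-* : ∀ {a b c} → Coprime a c → Coprime b c → Coprime (a * b) c
coprime-* {a} ac bc {d} (d∣ab , d∣c) = bc (coprime-divisor da d∣ab , d∣c)
  where
  da : Coprime d a
  da (e∣d , e∣a) = ac (e∣a , ∣-trans e∣d d∣c)

coprime-^ : ∀ {a c} k → Coprime a c → Coprime (a ^ k) c
coprime-^ zero    ac (d∣1 , _) = ∣1⇒≡1 d∣1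
coprime-^ (suc k) ac = coprime-* ac (coprime-^ k ac)

prime^-∤⇒coprime : ∀ {p m} k → Prime p → ¬ p ∣ m → Coprime (p ^ k) m
prime^-∤⇒coprime k pp p∤m = coprime-^ k (prime-∤⇒coprime pp p∤m)

coprime-*-∣ : ∀ {a b N} → Coprime a b → a ∣ N → b ∣ N → a * b ∣ N
coprime-*-∣ {a} {b} ab (divides q refl) b∣N = subst (_∣ q * a) (*-comm b a)
  (*-monoˡ-∣ a (coprime-divisor (coprime-sym ab) (subst (b ∣_) (*-comm q a) b∣N)))

prime-part : ∀ {p} → Prime p → ∀ d → 0 < d →
             ∃[ k ] ∃[ m ] (d ≡ p ^ k * m × ¬ p ∣ m)
prime-part {p} pp = <-rec _ go
  where
  go : ∀ d → (∀ {d′} → d′ < d → 0 < d′ → ∃[ k ] ∃[ m ] (d′ ≡ p ^ k * m × ¬ p ∣ m)) →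
       0 < d → ∃[ k ] ∃[ m ] (d ≡ p ^ k * m × ¬ p ∣ m)
  go d rec 0<d with p ∣? d
  ... | no p∤d = 0 , d , sym (*-identityˡ d) , p∤d
  ... | yes (divides zero refl) = contradiction refl (>⇒≢ 0<d)
  ... | yes (divides q@(suc _) refl)
    with rec (m<m*n q p (prime>1 pp)) z<s
  ...   | k , m , eqn , p∤m = suc k , m ,
    trans (cong (_* p) eqn) (trans (*-comm _ p) (sym (*-assoc p (p ^ k) m))) , p∤m

∣-prime^ : ∀ {p} → Prime p → ∀ a {d} → d ∣ p ^ a → ∃[ i ] (i ≤ a × d ≡ p ^ i)
∣-prime^ {p} pp zero    d∣ = 0 , z≤n , ∣1⇒≡1 d∣
∣-prime^ {p} pp (suc a) {d} d∣ with p ∣? d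
... | no p∤d with ∣-prime^ pp a (coprime-divisor (coprime-sym (prime-∤⇒coprime pp p∤d)) d∣)
...   | i , i≤a , eqn = i , m≤n⇒m≤1+n i≤a , eqn
∣-prime^ {p} pp (suc a) {d} d∣ | yes (divides q refl)
  with ∣-prime^ pp a (*-cancelʳ-∣ {m = q} p {{prime⇒nonZero pp}} (subst (q * p ∣_) (*-comm p _) d∣))
... | i , i≤a , eqn = suc i , s≤s i≤a , trans (cong (_* p) eqn) (*-comm _ p)

prime^>0 : ∀ {p} → Prime p → ∀ k → 0 < p ^ k
prime^>0 pp k = m^n>0 _ {{prime⇒nonZero pp}} k

^-mono-∣ : ∀ p {a b} → a ≤ b → p ^ a ∣ p ^ b
^-mono-∣ p {a} {b} a≤b = subst (p ^ a ∣_)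
  (trans (sym (^-distribˡ-+-* p a (b ∸ a))) (cong (p ^_) (m+[n∸m]≡n a≤b))) (m∣m*n _)

^-∣⇒≤ : ∀ {p} → Prime p → ∀ a b → p ^ a ∣ p ^ b → a ≤ b
^-∣⇒≤ {p} pp a b d = ≮⇒≥ λ b<a →
  <⇒≱ (^-monoʳ-< p (prime>1 pp) b<a) (∣⇒≤ {{>-nonZero (prime^>0 pp b)}} d)

∣-prime-part : ∀ {p} → Prime p → ∀ k e {m} → ¬ p ∣ m → p ^ e ∣ p ^ k * m → p ^ e ∣ p ^ k
∣-prime-part {p} pp k e {m} p∤m h =
  coprime-divisor (prime^-∤⇒coprime e pp p∤m) (subst (p ^ e ∣_) (*-comm (p ^ k) m) h)

-- Induction on `d`, splitting off the full power of one prime: this power and its cofactor are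
-- coprime, so their product divides `N` as soon as each does.
∣-from-prime-powers : ∀ d → 0 < d → ∀ {N} →
  (∀ {q} → Prime q → ∀ e → q ^ e ∣ d → q ^ e ∣ N) → d ∣ N
∣-from-prime-powers = <-rec _ go
  where
  go : ∀ d → (∀ {d′} → d′ < d → 0 < d′ → ∀ {N} →
         (∀ {q} → Prime q → ∀ e → q ^ e ∣ d′ → q ^ e ∣ N) → d′ ∣ N) →
       0 < d → ∀ {N} → (∀ {q} → Prime q → ∀ e → q ^ e ∣ d → q ^ e ∣ N) → d ∣ N
  go (suc zero) rec _ h = 1∣ _
  go d@(suc (suc _)) rec 0<d {N} h with least-prime-factor {d} (s≤s z<s)
  ... | p , pp , p∣d , _ with prime-part pp d 0<d
  ...   | zero , m , eqn , p∤m =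
    contradiction (subst (p ∣_) (trans eqn (*-identityˡ m)) p∣d) p∤m
  ...   | suc k , m , eqn , p∤m = subst (_∣ N) (sym eqn)
    (coprime-*-∣ (prime^-∤⇒coprime (suc k) pp p∤m)
      (h pp (suc k) (subst (p ^ suc k ∣_) (sym eqn) (m∣m*n m)))
      (rec m<d 0<m λ pq e q∣m → h pq e (∣-trans q∣m (subst (m ∣_) (sym eqn) (n∣m*n (p ^ suc k))))))
    where
    0<m : 0 < m
    0<m = ∣⇒>0 (subst (m ∣_) (sym eqn) (n∣m*n (p ^ suc k))) 0<d
    m<d : m < d
    m<d = subst (m <_) (trans (*-comm m _) (sym eqn))
      (m<m*n m (p ^ suc k) {{>-nonZero 0<m}}
        (≤-trans (prime>1 pp) (subst (_≤ p ^ suc k) (^-identityʳ p) (^-monoʳ-≤ p {{prime⇒nonZero pp}} (s≤s {0} {k} z≤n)))))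

crt-idempotent : ∀ {k l} → Coprime k l → 0 < k → 0 < l →
                 ∃[ α ] ∃[ β ] (α * k ≡ 1 + β * l)
crt-idempotent {suc k} {suc l} co _ _ with coprime-Bézout co
... | Bézout.+- x y eqn = x , y , sym eqn
-- Here `x` is the negative of an inverse of `suc k` modulo `suc l`, and multiplying it by `l`
-- corrects the sign. The extra summand `suc l` keeps `β` free of subtraction.
... | Bézout.-+ x y eqn = x * l + suc l , y * l + k , (begin
  (x * l + suc l) * suc k
    ≡⟨ solve 3 (λ x l k → (x :* l :+ (con 1 :+ l)) :* (con 1 :+ k) :=
                  (con 1 :+ x :* (con 1 :+ k)) :* l :+ con 1 :+ k :* (con 1 :+ l)) refl x l k ⟩
  (1 + x * suc k) * l + 1 + k * suc l
    ≡⟨ cong (λ z → z * l + 1 + k * suc l) eqn ⟩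
  y * suc l * l + 1 + k * suc l
    ≡⟨ solve 3 (λ y l k → y :* (con 1 :+ l) :* l :+ con 1 :+ k :* (con 1 :+ l) :=
                  con 1 :+ (y :* l :+ k) :* (con 1 :+ l)) refl y l k ⟩
  1 + (y * l + k) * suc l ∎)
  where
  open ≡-Reasoning
  open +-*-Solver

-- Counting decidable subsets of a finite set

χ : {P : Set} → Dec P → ℕ
χ P? = if does P? then 1 else 0

-- Opaque, so that unification recovers the summand from a sum.
opaque
  sum : ∀ {n} → (Fin n → ℕ) → ℕ
  sum = Sum.sum

opaque
  count : ∀ {n} {P : Fin n → Set} → (∀ x → Dec (P x)) → ℕ
  count P? = sum λ x → χ (P? x)

opaque
  unfolding sum

  sum-[] : (f : Fin 0 → ℕ) → sum f ≡ 0
  sum-[] f = refl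

  sum-∷ : ∀ {n} (f : Fin (suc n) → ℕ) → sum f ≡ f zero + sum (f ∘ suc)
  sum-∷ f = refl

  sum-cong : ∀ {n} {f g : Fin n → ℕ} → (∀ x → f x ≡ g x) → sum f ≡ sum g
  sum-cong = Sum.sum-cong-≗

  sum-zero : ∀ {n} {f : Fin n → ℕ} → (∀ x → f x ≡ 0) → sum f ≡ 0
  sum-zero {n} h = trans (sum-cong h) (Sum.sum-replicate-zero n)

  sum-mono : ∀ {n} {f g : Fin n → ℕ} → (∀ x → f x ≤ g x) → sum f ≤ sum g
  sum-mono {zero}  h = z≤n
  sum-mono {suc n} h = +-mono-≤ (h zero) (sum-mono (h ∘ suc))

  sum-∣ : ∀ {n d} {f : Fin n → ℕ} → (∀ x → d ∣ f x) → d ∣ sum f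
  sum-∣ {zero}  h = _ ∣0
  sum-∣ {suc n} h = ∣m∣n⇒∣m+n (h zero) (sum-∣ (h ∘ suc))

  sum-+ : ∀ {n} (f g : Fin n → ℕ) → sum (λ x → f x + g x) ≡ sum f + sum g
  sum-+ = Sum.∑-distrib-+

  sum-comm : ∀ {m n} (f : Fin m → Fin n → ℕ) →
             sum (λ x → sum (f x)) ≡ sum (λ y → sum (λ x → f x y))
  sum-comm = Sum.∑-comm

  sum-*ʳ : ∀ {n} (f : Fin n → ℕ) c → sum f * c ≡ sum (λ x → f x * c)
  sum-*ʳ f c = Sum.*-distribʳ-sum c f

opaque
  unfolding count

  count≡sum : ∀ {n} {P : Fin n → Set} (P? : ∀ x → Dec (P x)) → count P? ≡ sum (λ x → χ (P? x))
  count≡sum P? = refl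

  count-[] : {P : Fin 0 → Set} (P? : ∀ x → Dec (P x)) → count P? ≡ 0
  count-[] P? = sum-[] _

  count-∷ : ∀ {n} {P : Fin (suc n) → Set} (P? : ∀ x → Dec (P x)) →
            count P? ≡ χ (P? zero) + count (P? ∘ suc)
  count-∷ P? = sum-∷ _

χ-yes : {P : Set} (P? : Dec P) → P → χ P? ≡ 1
χ-yes (yes _) p = refl
χ-yes (no ¬p) p = contradiction p ¬p

χ-no : {P : Set} (P? : Dec P) → ¬ P → χ P? ≡ 0
χ-no (yes p) ¬p = contradiction p ¬p
χ-no (no _)  ¬p = refl

χ-cong : {P Q : Set} (P? : Dec P) (Q? : Dec Q) → (P → Q) → (Q → P) → χ P? ≡ χ Q?
χ-cong (yes p) Q? f g = sym (χ-yes Q? (f p))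
χ-cong (no ¬p) Q? f g = sym (χ-no Q? (¬p ∘ g))

χ-mono : {P Q : Set} (P? : Dec P) (Q? : Dec Q) → (P → Q) → χ P? ≤ χ Q?
χ-mono (yes p) Q? f = ≤-reflexive (sym (χ-yes Q? (f p)))
χ-mono (no ¬p) Q? f = z≤n

χ-*-case : {P : Set} (P? : Dec P) {m w : ℕ} → (P → m ≡ w) → (¬ P → m ≡ 0) → m ≡ χ P? * w
χ-*-case (yes p) f g = trans (f p) (sym (+-identityʳ _))
χ-*-case (no ¬p) f g = g ¬p

χ-case : {P : Set} (P? : Dec P) {m : ℕ} → (P → m ≡ 1) → (¬ P → m ≡ 0) → χ P? ≡ m
χ-case P? f g = sym (trans (χ-*-case P? f g) (*-identityʳ _))

module _ {n} {P Q : Fin n → Set} (P? : ∀ x → Dec (P x)) (Q? : ∀ x → Dec (Q x)) where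

  opaque
    unfolding count

    count-cong : (∀ {x} → P x → Q x) → (∀ {x} → Q x → P x) → count P? ≡ count Q?
    count-cong f g = sum-cong λ x → χ-cong (P? x) (Q? x) f g

    count-mono : (∀ {x} → P x → Q x) → count P? ≤ count Q?
    count-mono f = sum-mono λ x → χ-mono (P? x) (Q? x) f

    count-split : count P? ≡ count (λ x → P? x ×-dec Q? x) + count (λ x → P? x ×-dec ¬? (Q? x))
    count-split = trans (sum-cong λ x → split (P? x) (Q? x)) (sum-+ _ _)
      where
      split : ∀ {A B : Set} (A? : Dec A) (B? : Dec B) →
              χ A? ≡ χ (A? ×-dec B?) + χ (A? ×-dec ¬? B?)
      split (yes _) (yes _) = refl
      split (yes _) (no _)  = refl
      split (no _)  B?      = refl

opaque
  unfolding count

  count-none : ∀ {n} {P : Fin n → Set} (P? : ∀ x → Dec (P x)) → (∀ x → ¬ P x) → count P? ≡ 0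
  count-none P? h = sum-zero λ x → χ-no (P? x) (h x)

  count-all : ∀ {n} {P : Fin n → Set} (P? : ∀ x → Dec (P x)) → (∀ x → P x) → count P? ≡ n
  count-all {zero}  P? h = sum-[] _
  count-all {suc n} P? h = trans (sum-∷ _) (cong₂ _+_ (χ-yes (P? zero) (h zero)) (count-all (P? ∘ suc) (h ∘ suc)))

  count-unique : ∀ {n} {P : Fin n → Set} (P? : ∀ x → Dec (P x)) {a} →
                 P a → (∀ {x} → P x → x ≡ a) → count P? ≡ 1
  count-unique P? {zero} Pa u = trans (sum-∷ _) (cong₂ _+_ (χ-yes (P? zero) Pa)
    (count-none (P? ∘ suc) λ x Px → contradiction (u Px) λ ()))
  count-unique P? {suc a} Pa u = trans (sum-∷ _) (cong₂ _+_ (χ-no (P? zero) λ P0 → contradiction (u P0) λ ())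
    (count-unique (P? ∘ suc) Pa (Fin.suc-injective ∘ u)))

count>0 : ∀ {n} {P : Fin n → Set} (P? : ∀ x → Dec (P x)) {a} → P a → 0 < count P?
count>0 P? {a} Pa = subst (_≤ count P?) (count-unique (_≟ᶠ a) refl id)
  (count-mono (_≟ᶠ a) P? λ { refl → Pa })

module _ {n} {P Q : Fin n → Set} (P? : ∀ x → Dec (P x)) (Q? : ∀ x → Dec (Q x)) where

  count-⊂ : (∀ {x} → P x → Q x) → ∀ {a} → Q a → ¬ P a → count P? < count Q?
  count-⊂ P⊆Q {a} Qa ¬Pa = subst (count P? <_) (sym (count-split Q? P?))
    (≤-<-trans (count-mono P? (λ x → Q? x ×-dec P? x) λ p → P⊆Q p , p)
      (m<m+n _ (count>0 (λ x → Q? x ×-dec ¬? (P? x)) (Qa , ¬Pa))))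

  count-≥⇒⊇ : (∀ {x} → P x → Q x) → count Q? ≤ count P? → ∀ {x} → Q x → P x
  count-≥⇒⊇ P⊆Q Q≤P {x} Qx with P? x
  ... | yes Px = Px
  ... | no ¬Px = contradiction Q≤P (<⇒≱ (count-⊂ P⊆Q Qx ¬Px))

  count-<⇒∃ : count P? < count Q? → ∃[ x ] (Q x × ¬ P x)
  count-<⇒∃ h with any? (λ x → Q? x ×-dec ¬? (P? x))
  ... | yes e = e
  ... | no ¬e = contradiction (count-mono Q? P? q⇒p) (<⇒≱ h)
    where
    q⇒p : ∀ {x} → Q x → P x
    q⇒p {x} Qx with P? x
    ... | yes Px = Px
    ... | no ¬Px = contradiction (x , Qx , ¬Px) ¬e

-- Sums the incidence matrix of `R` by rows and by columns. Bijections and the sizes of extensions,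
-- conjugacy classes and double cosets are all obtained from this.
double-count : ∀ {a b} {S : Fin a → Set} {T : Fin b → Set} {R : Fin a → Fin b → Set}
  (S? : ∀ x → Dec (S x)) (T? : ∀ y → Dec (T y)) (R? : ∀ x y → Dec (R x y)) →
  (∀ {x y} → R x y → S x × T y) → ∀ {r c} →
  (∀ {x} → S x → count (R? x) ≡ r) → (∀ {y} → T y → count (λ x → R? x y) ≡ c) →
  count S? * r ≡ count T? * c
double-count {a} {b} S? T? R? dom {r} {c} rows columns = begin
  count S? * r                        ≡⟨ cong (_* r) (count≡sum S?) ⟩
  sum (λ x → χ (S? x)) * r            ≡⟨ sum-*ʳ _ r ⟩
  sum (λ x → χ (S? x) * r)            ≡⟨ sum-cong row ⟨
  sum (λ x → count (R? x))            ≡⟨ sum-cong (λ x → count≡sum (R? x)) ⟩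
  sum (λ x → sum λ y → χ (R? x y))    ≡⟨ sum-comm (λ x y → χ (R? x y)) ⟩
  sum (λ y → sum λ x → χ (R? x y))    ≡⟨ sum-cong (λ y → count≡sum (λ x → R? x y)) ⟨
  sum (λ y → count λ x → R? x y)      ≡⟨ sum-cong column ⟩
  sum (λ y → χ (T? y) * c)            ≡⟨ sum-*ʳ _ c ⟨
  sum (λ y → χ (T? y)) * c            ≡⟨ cong (_* c) (count≡sum T?) ⟨
  count T? * c                        ∎
  where
  open ≡-Reasoning
  row : ∀ x → count (R? x) ≡ χ (S? x) * r
  row x = χ-*-case (S? x) rows λ ¬Sx → count-none (R? x) λ y Rxy → ¬Sx (proj₁ (dom Rxy))
  column : ∀ y → count (λ x → R? x y) ≡ χ (T? y) * c
  column y = χ-*-case (T? y) columns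
    λ ¬Ty → count-none (λ x → R? x y) λ x Rxy → ¬Ty (proj₂ (dom Rxy))

count-bij : ∀ {a b} {S : Fin a → Set} {T : Fin b → Set}
  (S? : ∀ x → Dec (S x)) (T? : ∀ y → Dec (T y)) (f : Fin a → Fin b) →
  (∀ {x} → S x → T (f x)) →
  (∀ {x x′} → S x → S x′ → f x ≡ f x′ → x ≡ x′) →
  (∀ {y} → T y → ∃[ x ] (S x × f x ≡ y)) →
  count S? ≡ count T?
count-bij S? T? f S⇒T inj sur =
  trans (sym (*-identityʳ _)) (trans
    (double-count S? T? (λ x y → S? x ×-dec (f x ≟ᶠ y))
      (λ { (Sx , refl) → Sx , S⇒T Sx })
      (λ {x} Sx → count-unique (λ y → S? x ×-dec (f x ≟ᶠ y)) (Sx , refl) λ { (_ , refl) → refl })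
      λ {y} Ty → let x , Sx , fx≡y = sur Ty in
        count-unique (λ x → S? x ×-dec (f x ≟ᶠ y)) (Sx , fx≡y)
          λ { (Sx′ , fx′≡y) → inj Sx′ Sx (trans fx′≡y (sym fx≡y)) })
    (*-identityʳ _))

fin-least : ∀ {n} {P : Fin n → Set} → (∀ x → Dec (P x)) → ∃ P →
            ∃[ a ] (P a × (∀ {x} → P x → a Fin.≤ x))
fin-least {suc n} P? (x , Px) with P? zero
... | yes P0 = zero , P0 , λ _ → z≤n
fin-least {suc n} P? (zero  , Px) | no ¬P0 = contradiction Px ¬P0
fin-least {suc n} {P} P? (suc x , Px) | no ¬P0 with fin-least (P? ∘ suc) (x , Px)
... | a , Pa , min = suc a , Pa , min′
  where
  min′ : ∀ {x} → P x → suc a Fin.≤ x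
  min′ {zero}  P0 = contradiction P0 ¬P0
  min′ {suc x} Px = s≤s (min Px)

-- Each class is represented by its least element, which makes the representatives a decidable
-- subset and avoids quotient sets.
module Partition {n} {X : Fin n → Set} (X? : ∀ x → Dec (X x))
  {_~_ : Fin n → Fin n → Set} (_~?_ : ∀ x y → Dec (x ~ y))
  (~-dom : ∀ {x y} → x ~ y → X x) (~-refl : ∀ {x} → X x → x ~ x)
  (~-sym : ∀ {x y} → x ~ y → y ~ x) (~-trans : ∀ {x y z} → x ~ y → y ~ z → x ~ z) where

  Rep : Fin n → Set
  Rep x = X x × (∀ y → y ~ x → x Fin.≤ y)

  Rep? : ∀ x → Dec (Rep x)
  Rep? x = X? x ×-dec all? (λ y → (y ~? x) →-dec (x ≤ᶠ? y))

  rep : ∀ {y} → X y → ∃[ x ] (Rep x × x ~ y)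
  rep {y} Xy with fin-least (_~? y) (y , ~-refl Xy)
  ... | x , x~y , min = x , (~-dom x~y , λ z z~x → min (~-trans z~x x~y)) , x~y

  rep-unique : ∀ {x x′ y} → Rep x → x ~ y → Rep x′ → x′ ~ y → x ≡ x′
  rep-unique (_ , min) x~y (_ , min′) x′~y = toℕ-injective (≤-antisym
    (min _ (~-trans x′~y (~-sym x~y))) (min′ _ (~-trans x~y (~-sym x′~y))))

  -- Every `y` in `X` has exactly one representative, so the sum can be regrouped by classes, each
  -- of which contributes a multiple of `d`.
  sum-partition-∣ : ∀ {d} (w : Fin n → ℕ) →
    (∀ {x} → X x → d ∣ sum (λ y → χ (x ~? y) * w y)) → d ∣ sum (λ y → χ (X? y) * w y)
  sum-partition-∣ {d} w h = subst (d ∣_) (sym eqn) (sum-∣ inner)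
    where
    R? : ∀ x y → Dec (Rep x × x ~ y)
    R? x y = Rep? x ×-dec (x ~? y)
    rep-count : ∀ y → χ (X? y) ≡ count (λ x → R? x y)
    rep-count y = χ-case (X? y)
      (λ Xy → let x , Rx , x~y = rep Xy in
        count-unique (λ x → R? x y) (Rx , x~y) λ (Rx′ , x′~y) → rep-unique Rx′ x′~y Rx x~y)
      (λ ¬Xy → count-none (λ x → R? x y) λ x (_ , x~y) → ¬Xy (~-dom (~-sym x~y)))
    eqn : sum (λ y → χ (X? y) * w y) ≡ sum (λ x → sum (λ y → χ (R? x y) * w y))
    eqn = trans
      (sum-cong λ y → trans (cong (_* w y) (trans (rep-count y) (count≡sum (λ x → R? x y)))) (sum-*ʳ _ (w y)))
      (sum-comm (λ y x → χ (R? x y) * w y))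
    inner : ∀ x → d ∣ sum (λ y → χ (R? x y) * w y)
    inner x = guarded (Rep? x) λ Rx → h (proj₁ Rx)
      where
      guarded : {A : Set} (A? : Dec A) → (A → d ∣ sum (λ y → χ (x ~? y) * w y)) →
                d ∣ sum (λ y → χ (A? ×-dec (x ~? y)) * w y)
      guarded (yes a) g = g a
      guarded (no _)  g = subst (d ∣_) (sym (sum-zero {f = λ _ → 0} λ _ → refl)) (d ∣0)

  count-partition-∣ : ∀ {d} → (∀ {x} → X x → d ∣ count (x ~?_)) → d ∣ count X?
  count-partition-∣ {d} h = subst (d ∣_) (trans (sum-cong λ y → *-identityʳ _) (sym (count≡sum X?)))
    (sum-partition-∣ (λ _ → 1) λ {x} Xx →
      subst (d ∣_) (trans (count≡sum (x ~?_)) (sum-cong λ y → sym (*-identityʳ _))) (h Xx))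

module Enumerate {n} {P : Fin n → Set} (P? : ∀ x → Dec (P x)) (default : Fin n) where

  below? : ∀ (x y : Fin n) → Dec (P y × toℕ y < toℕ x)
  below? x y = P? y ×-dec (toℕ y <? toℕ x)

  rank : Fin n → ℕ
  rank x = count (below? x)

  rank<count : ∀ {x} → P x → rank x < count P?
  rank<count {x} Px = count-⊂ (below? x) P? proj₁ Px λ (_ , x<x) → <-irrefl refl x<x

  rank-mono-< : ∀ {x y : Fin n} → P x → toℕ x < toℕ y → rank x < rank y
  rank-mono-< {x} {y} Px x<y = count-⊂ (below? x) (below? y)
    (λ (Pz , z<x) → Pz , <-trans z<x x<y) (Px , x<y) λ (_ , x<x) → <-irrefl refl x<x

  rank-injective : ∀ {x y} → P x → P y → rank x ≡ rank y → x ≡ y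
  rank-injective {x} {y} Px Py eqn with <-cmp (toℕ x) (toℕ y)
  ... | tri< x<y _ _ = contradiction eqn (<⇒≢ (rank-mono-< Px x<y))
  ... | tri≈ _ x≡y _ = toℕ-injective x≡y
  ... | tri> _ _ y<x = contradiction (sym eqn) (<⇒≢ (rank-mono-< Py y<x))

  element : ℕ → Fin n
  element i with any? (λ x → P? x ×-dec (rank x ≟ i))
  ... | yes (x , _) = x
  ... | no _        = default

  element-rank : ∀ {x} → P x → element (rank x) ≡ x
  element-rank {x} Px with any? (λ y → P? y ×-dec (rank y ≟ rank x))
  ... | yes (y , Py , eqn) = rank-injective Py Px eqn
  ... | no ¬∃ = contradiction (x , Px , refl) ¬∃

-- Powers, subgroups, cosets and cyclic groups

module GroupTheory {n} (G : FiniteGroup n) where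

  open FiniteGroup G public hiding (_^ᶻ_)
  open Group group public using (assoc; identityˡ; identityʳ; inverseˡ; inverseʳ; monoid)
  open GroupProperties group public using (∙-cancelˡ; ∙-cancelʳ; inverseʳ-unique)

  infixr 8 _↑_

  opaque
    _↑_ : Fin n → ℕ → Fin n
    x ↑ k = power rawMonoid k x

    ↑≡power : ∀ x k → x ↑ k ≡ power rawMonoid k x
    ↑≡power x k = refl

    ↑-0 : ∀ x → x ↑ 0 ≡ ε
    ↑-0 x = refl

    ↑-suc : ∀ x k → x ↑ suc k ≡ x ∙ x ↑ k
    ↑-suc x k = refl

    ↑-+ : ∀ x a b → x ↑ (a + b) ≡ x ↑ a ∙ x ↑ b
    ↑-+ = Mult.×-homo-+ monoid

    ↑-1 : ∀ x → x ↑ 1 ≡ x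
    ↑-1 = identityʳ

    ↑-* : ∀ x a b → x ↑ (a * b) ≡ (x ↑ b) ↑ a
    ↑-* x a b = sym (Mult.×-assocˡ monoid x a b)

  ↑-*′ : ∀ x a b → x ↑ (a * b) ≡ (x ↑ a) ↑ b
  ↑-*′ x a b = trans (cong (x ↑_) (*-comm a b)) (↑-* x b a)

  opaque
    unfolding _↑_

    ε↑ : ∀ k → ε ↑ k ≡ ε
    ε↑ zero    = refl
    ε↑ (suc k) = trans (identityˡ _) (ε↑ k)

  ↑-∣ : ∀ {x k l} → x ↑ k ≡ ε → k ∣ l → x ↑ l ≡ ε
  ↑-∣ {x} {k} h (divides q refl) = trans (↑-* x q k) (trans (cong (_↑ q) h) (ε↑ q))

  opaque
    unfolding _↑_

    ↑-1+ : ∀ {x l} → x ↑ l ≡ ε → ∀ β → x ↑ (1 + β * l) ≡ x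
    ↑-1+ {x} {l} h β = trans (cong (x ∙_) (↑-∣ {x} {l} h (n∣m*n β))) (identityʳ x)

  Commute : Fin n → Fin n → Set
  Commute x y = x ∙ y ≡ y ∙ x

  commute-∙ : ∀ {x y z} → Commute x z → Commute y z → Commute (x ∙ y) z
  commute-∙ {x} {y} {z} xz yz = begin
    x ∙ y ∙ z   ≡⟨ assoc x y z ⟩
    x ∙ (y ∙ z) ≡⟨ cong (x ∙_) yz ⟩
    x ∙ (z ∙ y) ≡⟨ assoc x z y ⟨
    x ∙ z ∙ y   ≡⟨ cong (_∙ y) xz ⟩
    z ∙ x ∙ y   ≡⟨ assoc z x y ⟩
    z ∙ (x ∙ y) ∎
    where open ≡-Reasoning

  commute-ε : ∀ {x} → Commute ε x
  commute-ε = trans (identityˡ _) (sym (identityʳ _))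

  opaque
    unfolding _↑_

    commute-↑ˡ : ∀ {x y} k → Commute x y → Commute (x ↑ k) y
    commute-↑ˡ zero    c = commute-ε
    commute-↑ˡ (suc k) c = commute-∙ c (commute-↑ˡ k c)

  commute-↑ʳ : ∀ {x y} k → Commute x y → Commute x (y ↑ k)
  commute-↑ʳ k c = sym (commute-↑ˡ k (sym c))

  opaque
    unfolding _↑_

    intertwine-↑ : ∀ {h x y} k → h ∙ x ≡ y ∙ h → h ∙ x ↑ k ≡ y ↑ k ∙ h
    intertwine-↑ zero    c = sym commute-ε
    intertwine-↑ {h} {x} {y} (suc k) c = begin
      h ∙ (x ∙ x ↑ k)   ≡⟨ assoc h x _ ⟨
      h ∙ x ∙ x ↑ k     ≡⟨ cong (_∙ x ↑ k) c ⟩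
      y ∙ h ∙ x ↑ k     ≡⟨ assoc y h _ ⟩
      y ∙ (h ∙ x ↑ k)   ≡⟨ cong (y ∙_) (intertwine-↑ k c) ⟩
      y ∙ (y ↑ k ∙ h)   ≡⟨ assoc y _ h ⟨
      y ∙ y ↑ k ∙ h     ∎
      where open ≡-Reasoning

    ∙-↑ : ∀ {x y} k → Commute x y → (x ∙ y) ↑ k ≡ x ↑ k ∙ y ↑ k
    ∙-↑ zero c = sym (identityˡ ε)
    ∙-↑ {x} {y} (suc k) c = begin
      x ∙ y ∙ (x ∙ y) ↑ k       ≡⟨ cong (x ∙ y ∙_) (∙-↑ k c) ⟩
      x ∙ y ∙ (x ↑ k ∙ y ↑ k)   ≡⟨ assoc x y _ ⟩
      x ∙ (y ∙ (x ↑ k ∙ y ↑ k)) ≡⟨ cong (x ∙_) (assoc y _ _) ⟨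
      x ∙ (y ∙ x ↑ k ∙ y ↑ k)   ≡⟨ cong (λ z → x ∙ (z ∙ y ↑ k)) (commute-↑ˡ k c) ⟨
      x ∙ (x ↑ k ∙ y ∙ y ↑ k)   ≡⟨ cong (x ∙_) (assoc _ y _) ⟩
      x ∙ (x ↑ k ∙ (y ∙ y ↑ k)) ≡⟨ assoc x _ _ ⟨
      x ↑ suc k ∙ y ↑ suc k     ∎
      where open ≡-Reasoning

  cancel-⁻¹∙ : ∀ x y → x ⁻¹ ∙ (x ∙ y) ≡ y
  cancel-⁻¹∙ x y = trans (sym (assoc _ x y)) (trans (cong (_∙ y) (inverseˡ x)) (identityˡ y))

  cancel-∙⁻¹ : ∀ x y → x ∙ (x ⁻¹ ∙ y) ≡ y
  cancel-∙⁻¹ x y = trans (sym (assoc x _ y)) (trans (cong (_∙ y) (inverseʳ x)) (identityˡ y))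

  opaque
    unfolding _↑_

    period : ∀ x → ∃[ k ] (0 < k × x ↑ k ≡ ε)
    period x with pigeonhole (n<1+n n) (λ (i : Fin (suc n)) → x ↑ toℕ i)
    ... | i , j , i<j , eqn = toℕ j ∸ toℕ i , m<n⇒0<n∸m i<j ,
      sym (∙-cancelˡ (x ↑ toℕ i) ε _ (begin
        x ↑ toℕ i ∙ ε                          ≡⟨ identityʳ _ ⟩
        x ↑ toℕ i                              ≡⟨ eqn ⟩
        x ↑ toℕ j                              ≡⟨ cong (x ↑_) (m+[n∸m]≡n (<⇒≤ i<j)) ⟨
        x ↑ (toℕ i + (toℕ j ∸ toℕ i))          ≡⟨ ↑-+ x (toℕ i) _ ⟩
        x ↑ toℕ i ∙ x ↑ (toℕ j ∸ toℕ i)        ∎))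
      where open ≡-Reasoning

  -- Closure under inverses is automatic in a finite group.
  record Sub (H : Fin n → Set) : Set where
    field
      mem? : ∀ x → Dec (H x)
      ε∈   : H ε
      ∙∈   : ∀ {x y} → H x → H y → H (x ∙ y)

    opaque
      unfolding _↑_

      ↑∈ : ∀ {x} k → H x → H (x ↑ k)
      ↑∈ zero    Hx = ε∈
      ↑∈ (suc k) Hx = ∙∈ Hx (↑∈ k Hx)

      ⁻¹∈ : ∀ {x} → H x → H (x ⁻¹)
      ⁻¹∈ {x} Hx with period x
      ... | suc k , _ , eqn = subst H (inverseʳ-unique x (x ↑ k) eqn) (↑∈ k Hx)

    cancelˡ : ∀ {x y} → H x → H (x ∙ y) → H y
    cancelˡ {x} {y} Hx Hxy = subst H (cancel-⁻¹∙ x y) (∙∈ (⁻¹∈ Hx) Hxy)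

    cancelʳ : ∀ {x y} → H y → H (x ∙ y) → H x
    cancelʳ {x} {y} Hy Hxy = subst H (trans (assoc x y _) (trans (cong (x ∙_) (inverseʳ y)) (identityʳ x)))
      (∙∈ Hxy (⁻¹∈ Hy))

    order : ℕ
    order = count mem?

    order>0 : 0 < order
    order>0 = count>0 mem? ε∈

    opaque
      -- For trivial `H` this `j` is the order of `x`; for `x` normalizing `H` it is the order of
      -- the image of `x` modulo `H`.
      relative-order : ∀ x → ∃[ j ] (0 < j × H (x ↑ j) × (∀ {k} → H (x ↑ k) → j ∣ k))
      relative-order x with period x
      ... | k , 0<k , eqn
        with least (λ i → 0 < i × H (x ↑ i)) (λ i → (0 <? i) ×-dec mem? (x ↑ i)) (0<k , subst H (sym eqn) ε∈)
      ...   | j@(suc _) , (0<j , Hj) , min = j , 0<j , Hj , λ {k} Hk → m%n≡0⇒n∣m k j (remainder k Hk)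
        where
        remainder : ∀ k → H (x ↑ k) → k % j ≡ 0
        remainder k Hk with k % j in eqn | m%n<n k j
        ... | zero  | _ = refl
        ... | suc r | r<j = contradiction (z<s , cancelʳ (↑∈ (k / j) Hj) (subst H
          (trans (cong (x ↑_) (trans (m≡m%n+[m/n]*n k j) (cong (_+ (k / j) * j) eqn)))
            (trans (↑-+ x (suc r) _) (cong (x ↑ suc r ∙_) (↑-* x (k / j) j)))) Hk)) (min r<j)

  Coset : (Fin n → Set) → Fin n → Fin n → Set
  Coset K a y = ∃[ h ] (K h × y ≡ a ∙ h)

  module _ {K : Fin n → Set} (SK : Sub K) where
    open Sub SK

    coset? : ∀ a y → Dec (Coset K a y)
    coset? a y = any? λ h → mem? h ×-dec (y ≟ᶠ a ∙ h)

    coset-refl : ∀ {a} → Coset K a a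
    coset-refl = ε , ε∈ , sym (identityʳ _)

    coset-sym : ∀ {a b} → Coset K a b → Coset K b a
    coset-sym {a} (h , Kh , refl) = h ⁻¹ , ⁻¹∈ Kh ,
      sym (trans (assoc a h _) (trans (cong (a ∙_) (inverseʳ h)) (identityʳ a)))

    coset-trans : ∀ {a b c} → Coset K a b → Coset K b c → Coset K a c
    coset-trans {a} (h , Kh , refl) (k , Kk , refl) = h ∙ k , ∙∈ Kh Kk , assoc a h k

    coset-count : ∀ a → count (coset? a) ≡ order
    coset-count a = sym (count-bij mem? (coset? a) (a ∙_)
      (λ Kh → _ , Kh , refl) (λ _ _ → ∙-cancelˡ a _ _) λ { (h , Kh , refl) → h , Kh , refl })

  lagrange : ∀ {K H} (SK : Sub K) (SH : Sub H) → (∀ {x} → K x → H x) → Sub.order SK ∣ Sub.order SH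
  lagrange {K} {H} SK SH K⊆H = count-partition-∣ λ {x} Hx → subst (Sub.order SK ∣_)
    (trans (sym (coset-count SK x)) (count-cong (coset? SK x) (x ~?_)
      (λ c → Hx , c) proj₂)) ∣-refl
    where
    open Sub SH
    _~?_ : ∀ x y → Dec (H x × Coset K x y)
    x ~? y = mem? x ×-dec coset? SK x y
    ~-sym : ∀ {x y} → H x × Coset K x y → H y × Coset K y x
    ~-sym (Hx , c@(h , Kh , refl)) = ∙∈ Hx (K⊆H Kh) , coset-sym SK c
    open Partition mem? _~?_ proj₁ (λ Hx → Hx , coset-refl SK) ~-sym
      (λ (Hx , c) (_ , d) → Hx , coset-trans SK c d)

  -- Expresses `x ⁻¹ ∙ h ∙ x ∈ K` without inverses. As `K` is finite and conjugation injective, this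
  -- inclusion is already an equality.
  Normalizes : Fin n → (Fin n → Set) → Set
  Normalizes x K = ∀ {h} → K h → ∃[ h′ ] (K h′ × h ∙ x ≡ x ∙ h′)

  opaque
    unfolding _↑_

    normalizes-↑ : ∀ {x K} → Normalizes x K → ∀ k → Normalizes (x ↑ k) K
    normalizes-↑ N zero {h} Kh = h , Kh , sym commute-ε
    normalizes-↑ {x} N (suc k) {h} Kh with N Kh
    ... | h′ , Kh′ , eqn with normalizes-↑ N k Kh′
    ...   | h″ , Kh″ , eq′ = h″ , Kh″ , (begin
      h ∙ (x ∙ x ↑ k)   ≡⟨ assoc h x _ ⟨
      h ∙ x ∙ x ↑ k     ≡⟨ cong (_∙ x ↑ k) eqn ⟩
      x ∙ h′ ∙ x ↑ k    ≡⟨ assoc x h′ _ ⟩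
      x ∙ (h′ ∙ x ↑ k)  ≡⟨ cong (x ∙_) eq′ ⟩
      x ∙ (x ↑ k ∙ h″)  ≡⟨ assoc x _ h″ ⟨
      x ∙ x ↑ k ∙ h″    ∎)
      where open ≡-Reasoning

  -- The subgroup K⟨x⟩, of order j |K|, where j is the least positive exponent with x ↑ j ∈ K.
  module Extension {K} (SK : Sub K) x (N : Normalizes x K) where
    private module K = Sub SK

    index : ℕ
    index = proj₁ (K.relative-order x)

    index>0 : 0 < index
    index>0 = proj₁ (proj₂ (K.relative-order x))

    ↑index∈ : K (x ↑ index)
    ↑index∈ = proj₁ (proj₂ (proj₂ (K.relative-order x)))

    index-∣ : ∀ {k} → K (x ↑ k) → index ∣ k
    index-∣ = proj₂ (proj₂ (proj₂ (K.relative-order x)))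

    Ext : Fin n → Set
    Ext y = ∃[ i ] Coset K (x ↑ toℕ {index} i) y

    ext-intro : ∀ k {h} → K h → Ext (x ↑ k ∙ h)
    -- The exponent is reduced modulo `index`; what is cut off is a power of `x ↑ index`, which `K`
    -- absorbs.
    ext-intro k {h} Kh = fromℕ< {k % index} (m%n<n k index) , (x ↑ index) ↑ (k / index) ∙ h ,
      K.∙∈ (K.↑∈ (k / index) ↑index∈) Kh , (begin
        x ↑ k ∙ h
          ≡⟨ cong (λ i → x ↑ i ∙ h) (m≡m%n+[m/n]*n k index) ⟩
        x ↑ (k % index + k / index * index) ∙ h
          ≡⟨ cong (_∙ h) (↑-+ x (k % index) _) ⟩
        x ↑ (k % index) ∙ x ↑ (k / index * index) ∙ h
          ≡⟨ assoc _ _ h ⟩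
        x ↑ (k % index) ∙ (x ↑ (k / index * index) ∙ h)
          ≡⟨ cong₂ (λ i y → x ↑ i ∙ (y ∙ h)) (toℕ-fromℕ< _) (sym (↑-* x (k / index) index)) ⟨
        x ↑ toℕ (fromℕ< (m%n<n k index)) ∙ ((x ↑ index) ↑ (k / index) ∙ h) ∎)
      where
      open ≡-Reasoning
      instance
        index≢0 : NonZero index
        index≢0 = >-nonZero index>0

    K⊆ext : ∀ {h} → K h → Ext h
    K⊆ext Kh = subst Ext (trans (cong (_∙ _) (↑-0 x)) (identityˡ _)) (ext-intro 0 Kh)

    x∈ext : Ext x
    x∈ext = subst Ext (trans (identityʳ _) (↑-1 x)) (ext-intro 1 K.ε∈)

    ext-sub : Sub Ext
    ext-sub = record
      { mem? = λ y → any? λ i → coset? SK (x ↑ toℕ i) y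
      ; ε∈ = K⊆ext K.ε∈
      ; ∙∈ = λ { (i , h , Kh , refl) (j , k , Kk , refl) → closed (toℕ i) Kh (toℕ j) Kk } }
      where
      open ≡-Reasoning
      closed : ∀ i {h} (Kh : K h) j {k} (Kk : K k) → Ext (x ↑ i ∙ h ∙ (x ↑ j ∙ k))
      closed i {h} Kh j {k} Kk with normalizes-↑ N j Kh
      ... | h′ , Kh′ , eqn = subst Ext (begin
        x ↑ (i + j) ∙ (h′ ∙ k)      ≡⟨ cong (_∙ (h′ ∙ k)) (↑-+ x i j) ⟩
        x ↑ i ∙ x ↑ j ∙ (h′ ∙ k)    ≡⟨ assoc _ _ _ ⟩
        x ↑ i ∙ (x ↑ j ∙ (h′ ∙ k))  ≡⟨ cong (x ↑ i ∙_) (assoc _ h′ k) ⟨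
        x ↑ i ∙ (x ↑ j ∙ h′ ∙ k)    ≡⟨ cong (λ y → x ↑ i ∙ (y ∙ k)) eqn ⟨
        x ↑ i ∙ (h ∙ x ↑ j ∙ k)     ≡⟨ cong (x ↑ i ∙_) (assoc h _ k) ⟩
        x ↑ i ∙ (h ∙ (x ↑ j ∙ k))   ≡⟨ assoc _ h _ ⟨
        x ↑ i ∙ h ∙ (x ↑ j ∙ k)     ∎)
        (ext-intro (i + j) (K.∙∈ Kh′ Kk))

    -- The cosets of `x ↑ i` for `i < index` are disjoint: if two exponents give the same coset,
    -- then `index` divides their difference.
    ext-order : Sub.order ext-sub ≡ index * K.order
    ext-order = sym (begin
      index * K.order
        ≡⟨ cong (_* K.order) (count-all all-yes (λ _ → _)) ⟨
      count all-yes * K.order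
        ≡⟨ double-count all-yes (Sub.mem? ext-sub) (λ i y → coset? SK (x ↑ toℕ i) y)
             (λ {i} c → _ , (i , c)) {K.order} {1} (λ {i} _ → coset-count SK (x ↑ toℕ i))
             (λ {y} (i , c) → count-unique (λ i → coset? SK (x ↑ toℕ i) y) c λ {i′} c′ → unique c′ c) ⟩
      Sub.order ext-sub * 1
        ≡⟨ *-identityʳ _ ⟩
      Sub.order ext-sub ∎)
      where
      open ≡-Reasoning
      all-yes : (i : Fin index) → Dec ⊤
      all-yes _ = yes _
      ≤-unique : ∀ {i i′ : Fin index} {y} → toℕ i ≤ toℕ i′ →
                 Coset K (x ↑ toℕ i) y → Coset K (x ↑ toℕ i′) y → toℕ i ≡ toℕ i′
      ≤-unique {i} {i′} i≤i′ c c′ with coset-trans SK c (coset-sym SK c′)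
      ... | h , Kh , eqn with toℕ i′ ∸ toℕ i in eq∸ | index-∣ {toℕ i′ ∸ toℕ i} (subst K (∙-cancelˡ (x ↑ toℕ i) _ _
        (trans (sym eqn) (trans (cong (x ↑_) (sym (m+[n∸m]≡n i≤i′))) (↑-+ x (toℕ i) _)))) Kh)
      ...   | zero  | _ = ≤-antisym i≤i′ (m∸n≡0⇒m≤n eq∸)
      ...   | suc r | idx∣ = contradiction (∣⇒≤ idx∣)
        (<⇒≱ (subst (_< index) eq∸ (≤-<-trans (m∸n≤m (toℕ i′) (toℕ i)) (toℕ<n i′))))
      unique : ∀ {i i′ : Fin index} {y} → Coset K (x ↑ toℕ i) y → Coset K (x ↑ toℕ i′) y → i ≡ i′
      unique {i} {i′} c c′ with ≤-total (toℕ i) (toℕ i′)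
      ... | inj₁ i≤i′ = toℕ-injective (≤-unique i≤i′ c c′)
      ... | inj₂ i′≤i = toℕ-injective (sym (≤-unique i′≤i c′ c))

    ext-⊆ : ∀ {H} → Sub H → (∀ {h} → K h → H h) → H x → ∀ {y} → Ext y → H y
    ext-⊆ SH K⊆H Hx (i , h , Kh , refl) = Sub.∙∈ SH (Sub.↑∈ SH (toℕ i) Hx) (K⊆H Kh)

  Trivial : Fin n → Set
  Trivial x = x ≡ ε

  trivial-sub : Sub Trivial
  trivial-sub = record { mem? = _≟ᶠ ε ; ε∈ = refl ; ∙∈ = λ { refl refl → identityˡ ε } }

  trivial-order : Sub.order trivial-sub ≡ 1
  trivial-order = count-unique (_≟ᶠ ε) refl id

  normalizes-trivial : ∀ x → Normalizes x Trivial
  normalizes-trivial x refl = ε , refl , commute-ε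

  module Cyclic (x : Fin n) = Extension trivial-sub x (normalizes-trivial x)

  open Cyclic public using () renaming
    ( Ext to ⟨_⟩; ext-sub to ⟨⟩-sub; index to ord; index>0 to ord>0; ↑index∈ to ↑ord; index-∣ to ord-∣; x∈ext to x∈⟨x⟩ )

  ⟨⟩-order : ∀ x → Sub.order (⟨⟩-sub x) ≡ ord x
  ⟨⟩-order x = trans (Cyclic.ext-order x) (trans (cong (ord x *_) trivial-order) (*-identityʳ _))

  ⟨⟩-intro : ∀ x k → ⟨ x ⟩ (x ↑ k)
  ⟨⟩-intro x k = subst ⟨ x ⟩ (identityʳ _) (Cyclic.ext-intro x k refl)

  ⟨⟩-elim : ∀ {x y} → ⟨ x ⟩ y → ∃[ i ] (i < ord x × y ≡ x ↑ i)
  ⟨⟩-elim (i , _ , refl , refl) = toℕ i , toℕ<n i , identityʳ _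

  ⟨⟩-⊆ : ∀ {H x} → Sub H → H x → ∀ {y} → ⟨ x ⟩ y → H y
  ⟨⟩-⊆ {x = x} SH Hx = Cyclic.ext-⊆ x SH (λ { refl → Sub.ε∈ SH }) Hx

  ↑-order : ∀ {H x} (SH : Sub H) → H x → x ↑ Sub.order SH ≡ ε
  ↑-order {x = x} SH Hx = ↑-∣ {x} {ord x} (↑ord x)
    (subst (_∣ Sub.order SH) (⟨⟩-order x) (lagrange (⟨⟩-sub x) SH (⟨⟩-⊆ SH Hx)))

  coprime-periods : ∀ {x k l} → Coprime k l → x ↑ k ≡ ε → x ↑ l ≡ ε → x ≡ ε
  coprime-periods {x} co hk hl = trans (sym (↑-1 x))
    (subst (λ o → x ↑ o ≡ ε) (co (ord-∣ x hk , ord-∣ x hl)) (↑ord x))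

  -- Frobenius' theorem for full prime powers

  whole-sub : Sub (λ _ → ⊤)
  whole-sub = record { mem? = λ _ → yes _ ; ε∈ = _ ; ∙∈ = λ _ _ → _ }

  whole-order : Sub.order whole-sub ≡ n
  whole-order = count-all _ _

  ↑n : ∀ x → x ↑ n ≡ ε
  ↑n x = subst (λ k → x ↑ k ≡ ε) whole-order (↑-order {x = x} whole-sub _)

  Centralizer : (Fin n → Set) → Fin n → Fin n → Set
  Centralizer H u s = H s × Commute s u

  centralizer-sub : ∀ {H} → Sub H → ∀ u → Sub (Centralizer H u)
  centralizer-sub SH u = record
    { mem? = λ s → mem? s ×-dec (s ∙ u ≟ᶠ u ∙ s)
    ; ε∈ = ε∈ , commute-ε
    ; ∙∈ = λ (Hx , cx) (Hy , cy) → ∙∈ Hx Hy , commute-∙ cx cy }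
    where open Sub SH

  roots : ∀ {H} → Sub H → ℕ → ℕ
  roots SH k = count λ s → Sub.mem? SH s ×-dec (s ↑ k ≟ᶠ ε)

  -- With e ≡ 1 mod l and e ≡ 0 mod k, an x with x ↑ (k * l) ≡ ε is uniquely a product of a
  -- commuting pair with periods l and k, the first factor being x ↑ e.
  module CoprimeParts {k l} (co : Coprime k l) (0<k : 0 < k) (0<l : 0 < l) where

    private
      α = proj₁ (crt-idempotent co 0<k 0<l)
      β = proj₁ (proj₂ (crt-idempotent co 0<k 0<l))
      αk≡ : α * k ≡ 1 + β * l
      αk≡ = proj₂ (proj₂ (crt-idempotent co 0<k 0<l))

    l-part : Fin n → Fin n
    l-part x = x ↑ (α * k)

    -- This is the power of `x` with exponent `- β * l`. As a quotient it needs no negative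
    -- exponent, and the factorization of `x` is a mere cancellation.
    k-part : Fin n → Fin n
    k-part x = l-part x ⁻¹ ∙ x

    ∙-parts : ∀ x → x ≡ l-part x ∙ k-part x
    ∙-parts x = sym (cancel-∙⁻¹ (l-part x) x)

    k-part-commute : ∀ x → Commute (k-part x) (l-part x)
    k-part-commute x = begin
      l-part x ⁻¹ ∙ x ∙ l-part x    ≡⟨ assoc _ x _ ⟩
      l-part x ⁻¹ ∙ (x ∙ l-part x)  ≡⟨ cong (l-part x ⁻¹ ∙_) (commute-↑ʳ (α * k) refl) ⟩
      l-part x ⁻¹ ∙ (l-part x ∙ x)  ≡⟨ cancel-⁻¹∙ _ x ⟩
      x                             ≡⟨ ∙-parts x ⟩
      l-part x ∙ k-part x           ∎
      where open ≡-Reasoning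

    module _ {x} (xkl : x ↑ (k * l) ≡ ε) where

      l-part-period : l-part x ↑ l ≡ ε
      l-part-period = trans (sym (↑-*′ x (α * k) l))
        (↑-∣ xkl (subst (k * l ∣_) (sym (*-assoc α k l)) (n∣m*n α)))

      k-part-period : k-part x ↑ k ≡ ε
      k-part-period = sym (∙-cancelˡ (l-part x ↑ k) ε _ (begin
        l-part x ↑ k ∙ ε               ≡⟨ identityʳ _ ⟩
        l-part x ↑ k                   ≡⟨ ↑-*′ x (α * k) k ⟨
        x ↑ (α * k * k)                ≡⟨ cong (λ a → x ↑ (a * k)) αk≡ ⟩
        x ↑ ((1 + β * l) * k)          ≡⟨ ↑-* x (1 + β * l) k ⟩
        (x ↑ k) ↑ (1 + β * l)          ≡⟨ ↑-1+ {x ↑ k} {l} (trans (sym (↑-*′ x k l)) xkl) β ⟩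
        x ↑ k                          ≡⟨ cong (_↑ k) (∙-parts x) ⟩
        (l-part x ∙ k-part x) ↑ k      ≡⟨ ∙-↑ k (sym (k-part-commute x)) ⟩
        l-part x ↑ k ∙ k-part x ↑ k    ∎))
        where open ≡-Reasoning

    l-part∈ : ∀ {H x} → Sub H → H x → H (l-part x)
    l-part∈ SH Hx = Sub.↑∈ SH (α * k) Hx

    k-part∈ : ∀ {H x} → Sub H → H x → H (k-part x)
    k-part∈ SH Hx = Sub.∙∈ SH (Sub.⁻¹∈ SH (l-part∈ SH Hx)) Hx

    l-part-∙ : ∀ {u s} → Commute s u → u ↑ l ≡ ε → s ↑ k ≡ ε → l-part (u ∙ s) ≡ u
    l-part-∙ {u} {s} su ul sk = begin
      (u ∙ s) ↑ (α * k)          ≡⟨ ∙-↑ (α * k) (sym su) ⟩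
      u ↑ (α * k) ∙ s ↑ (α * k)  ≡⟨ cong₂ _∙_ (cong (u ↑_) αk≡) (↑-∣ {s} {k} sk (n∣m*n α)) ⟩
      u ↑ (1 + β * l) ∙ ε        ≡⟨ identityʳ _ ⟩
      u ↑ (1 + β * l)            ≡⟨ ↑-1+ {u} {l} ul β ⟩
      u                          ∎
      where open ≡-Reasoning

    module _ {H} (SH : Sub H) where
      open Sub SH

      root? : ∀ k x → Dec (H x × x ↑ k ≡ ε)
      root? k x = mem? x ×-dec (x ↑ k ≟ᶠ ε)

      -- The roots are grouped by their `l`-part `u`. The fibre over `u` consists of the `u ∙ s`
      -- with `s ↑ k ≡ ε` in the centralizer of `u`.
      roots-decomposition : roots SH (k * l) ≡
        sum λ u → χ (root? l u) * roots (centralizer-sub SH u) k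
      roots-decomposition = begin
        roots SH (k * l)                       ≡⟨ count≡sum (root? (k * l)) ⟩
        sum (λ x → χ (root? (k * l) x))        ≡⟨ sum-cong row ⟩
        sum (λ x → count (λ u → R? u x))       ≡⟨ sum-cong (λ x → count≡sum (λ u → R? u x)) ⟩
        sum (λ x → sum λ u → χ (R? u x))       ≡⟨ sum-comm (λ x u → χ (R? u x)) ⟩
        sum (λ u → sum λ x → χ (R? u x))       ≡⟨ sum-cong (λ u → count≡sum (R? u)) ⟨
        sum (λ u → count (R? u))               ≡⟨ sum-cong column ⟩
        sum (λ u → χ (root? l u) * roots (centralizer-sub SH u) k) ∎
        where
        open ≡-Reasoning
        S : Fin n → Fin n → Set
        S u s = Centralizer H u s × s ↑ k ≡ ε
        S? : ∀ u s → Dec (S u s)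
        S? u s = Sub.mem? (centralizer-sub SH u) s ×-dec (s ↑ k ≟ᶠ ε)
        R : Fin n → Fin n → Set
        R u x = (H u × u ↑ l ≡ ε) × ∃[ s ] (S u s × x ≡ u ∙ s)
        R? : ∀ u x → Dec (R u x)
        R? u x = root? l u ×-dec any? (λ s → S? u s ×-dec (x ≟ᶠ u ∙ s))
        row : ∀ x → χ (root? (k * l) x) ≡ count (λ u → R? u x)
        row x = χ-case (root? (k * l) x)
          (λ (Hx , xkl) → count-unique (λ u → R? u x)
            ((l-part∈ SH Hx , l-part-period xkl) , k-part x ,
             ((k-part∈ SH Hx , k-part-commute x) , k-part-period xkl) , ∙-parts x)
            λ { ((_ , ul) , s , ((_ , su) , sk) , refl) → sym (l-part-∙ su ul sk) })
          (λ ¬root → count-none (λ u → R? u x)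
            λ { u ((Hu , ul) , s , ((Hs , su) , sk) , refl) → ¬root (∙∈ Hu Hs ,
              trans (∙-↑ (k * l) (sym su)) (trans
                (cong₂ _∙_ (↑-∣ {u} {l} ul (n∣m*n k)) (↑-∣ {s} {k} sk (m∣m*n l))) (identityˡ ε))) })
        column : ∀ u → count (R? u) ≡ χ (root? l u) * roots (centralizer-sub SH u) k
        column u = χ-*-case (root? l u)
          (λ ru → sym (count-bij (S? u) (R? u) (u ∙_)
            (λ Ss → ru , _ , Ss , refl) (λ _ _ → ∙-cancelˡ u _ _)
            λ { (_ , s , Ss , refl) → s , Ss , refl }))
          (λ ¬ru → count-none (R? u) λ x (ru , _) → ¬ru ru)

  -- Meant for the size `N` of a class, the order `c` of a centralizer and a weight `w`: since `w`
  -- contains the whole power of `q` in `c`, replacing `c` by `w` loses no factor `q`.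
  prime-power-∣-* : ∀ {q} → Prime q → ∀ {c w} → 0 < c → (∀ e → q ^ e ∣ c → q ^ e ∣ w) →
                    ∀ {e} N → q ^ e ∣ N * c → q ^ e ∣ N * w
  prime-power-∣-* {q} pq {c} {w} 0<c h {e} N d with prime-part pq c 0<c
  ... | k , m , refl , q∤m = ∣-trans
    (coprime-divisor (prime^-∤⇒coprime e pq q∤m)
      (subst (q ^ e ∣_) (trans (sym (*-assoc N (q ^ k) m)) (*-comm _ m)) d))
    (*-monoʳ-∣ N (h k (m∣m*n m)))

  module Conjugacy {H} (SH : Sub H) {Y : Fin n → Set} (Y? : ∀ x → Dec (Y x))
    (Y-conj : ∀ {h x y} → H h → h ∙ x ≡ y ∙ h → Y x → Y y) where

    open Sub SH

    Conj : Fin n → Fin n → Set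
    Conj x y = Y x × ∃[ h ] (H h × h ∙ x ≡ y ∙ h)

    _~?_ : ∀ x y → Dec (Conj x y)
    x ~? y = Y? x ×-dec any? (λ h → mem? h ×-dec (h ∙ x ≟ᶠ y ∙ h))

    conj-⁻¹ : ∀ {h x y} → h ∙ x ≡ y ∙ h → h ⁻¹ ∙ y ≡ x ∙ h ⁻¹
    conj-⁻¹ {h} {x} {y} eqn = ∙-cancelˡ h _ _ (begin
      h ∙ (h ⁻¹ ∙ y)     ≡⟨ cancel-∙⁻¹ h y ⟩
      y                  ≡⟨ identityʳ y ⟨
      y ∙ ε              ≡⟨ cong (y ∙_) (inverseʳ h) ⟨
      y ∙ (h ∙ h ⁻¹)     ≡⟨ assoc y h _ ⟨
      y ∙ h ∙ h ⁻¹       ≡⟨ cong (_∙ h ⁻¹) eqn ⟨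
      h ∙ x ∙ h ⁻¹       ≡⟨ assoc h x _ ⟩
      h ∙ (x ∙ h ⁻¹)     ∎)
      where open ≡-Reasoning

    conj-∙ : ∀ {g h x y z} → h ∙ x ≡ y ∙ h → g ∙ y ≡ z ∙ g → g ∙ h ∙ x ≡ z ∙ (g ∙ h)
    conj-∙ {g} {h} {x} {y} {z} e₁ e₂ = begin
      g ∙ h ∙ x    ≡⟨ assoc g h x ⟩
      g ∙ (h ∙ x)  ≡⟨ cong (g ∙_) e₁ ⟩
      g ∙ (y ∙ h)  ≡⟨ assoc g y h ⟨
      g ∙ y ∙ h    ≡⟨ cong (_∙ h) e₂ ⟩
      z ∙ g ∙ h    ≡⟨ assoc z g h ⟩
      z ∙ (g ∙ h)  ∎
      where open ≡-Reasoning

    open Partition Y? _~?_ proj₁ (λ Yx → Yx , ε , ε∈ , commute-ε)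
      (λ (Yx , h , Hh , eqn) → Y-conj Hh eqn Yx , h ⁻¹ , ⁻¹∈ Hh , conj-⁻¹ eqn)
      (λ (Yx , h , Hh , e₁) (_ , g , Hg , e₂) → Yx , g ∙ h , ∙∈ Hg Hh , conj-∙ e₁ e₂)

    -- Orbit-stabilizer: the elements of `H` that conjugate `x` to a given `y` of its class form a
    -- left coset of the centralizer of `x`.
    class-order : ∀ {x} → Y x → count (x ~?_) * Sub.order (centralizer-sub SH x) ≡ order
    class-order {x} Yx = trans
      (double-count (x ~?_) mem? (λ y h → mem? h ×-dec (h ∙ x ≟ᶠ y ∙ h))
        (λ (Hh , eqn) → (Yx , _ , Hh , eqn) , Hh)
        (λ {y} (_ , h , Hh , eqn) → sym (count-bij
          (Sub.mem? (centralizer-sub SH x)) (λ g → mem? g ×-dec (g ∙ x ≟ᶠ y ∙ g)) (h ∙_)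
          (λ (Hs , sx) → ∙∈ Hh Hs , conj-∙ sx eqn)
          (λ _ _ → ∙-cancelˡ h _ _)
          λ {g} (Hg , e₂) → h ⁻¹ ∙ g , (∙∈ (⁻¹∈ Hh) Hg , conj-∙ e₂ (conj-⁻¹ eqn)) , cancel-∙⁻¹ h g))
        (λ {h} Hh → count-unique (λ y → mem? h ×-dec (h ∙ x ≟ᶠ y ∙ h)) {h ∙ x ∙ h ⁻¹}
          (Hh , sym (trans (assoc _ _ h) (trans (cong (h ∙ x ∙_) (inverseˡ h)) (identityʳ _))))
          λ {y} (_ , eqn) → ∙-cancelʳ h _ _ (trans (sym eqn)
            (sym (trans (assoc _ _ h) (trans (cong (h ∙ x ∙_) (inverseˡ h)) (identityʳ _)))))))
      (*-identityʳ order)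

    -- By `class-order` the size of a class lacks at most the power of `q` in the order of the
    -- centralizer, and the common weight of the class supplies exactly that power.
    class-sum-∣ : ∀ {q} → Prime q → (w : Fin n → ℕ) →
      (∀ {h x y} → H h → h ∙ x ≡ y ∙ h → Y x → w y ≡ w x) →
      (∀ {x} → Y x → ∀ e → q ^ e ∣ Sub.order (centralizer-sub SH x) → q ^ e ∣ w x) →
      ∀ e → q ^ e ∣ order → q ^ e ∣ sum (λ x → χ (Y? x) * w x)
    class-sum-∣ {q} pq w w-conj w-∣ e d = sum-partition-∣ w λ {x} Yx →
      subst (q ^ e ∣_) (trans (cong (_* w x) (count≡sum (x ~?_)))
          (trans (sum-*ʳ (λ y → χ (x ~? y)) (w x)) (sum-cong (weight x))))
        (prime-power-∣-* pq (Sub.order>0 (centralizer-sub SH x)) (w-∣ Yx) {e} (count (x ~?_))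
          (subst (q ^ e ∣_) (sym (class-order Yx)) d))
      where
      weight : ∀ x y → χ (x ~? y) * w x ≡ χ (x ~? y) * w y
      weight x y = helper (x ~? y) λ (Yx , h , Hh , eqn) → sym (w-conj Hh eqn Yx)
        where
        helper : {A : Set} (A? : Dec A) → (A → w x ≡ w y) → χ A? * w x ≡ χ A? * w y
        helper (yes a) f = cong (1 *_) (f a)
        helper (no _)  f = refl

  -- Conjugation by `h` carries the centralizer of `x` onto that of `y` and preserves periods.
  roots-centralizer-conj : ∀ {H} (SH : Sub H) k {h x y} → H h → h ∙ x ≡ y ∙ h →
    roots (centralizer-sub SH y) k ≡ roots (centralizer-sub SH x) k
  roots-centralizer-conj {H} SH k {h} {x} {y} Hh hx≡yh = sym (count-bij
    (λ s → Sub.mem? (centralizer-sub SH x) s ×-dec (s ↑ k ≟ᶠ ε))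
    (λ s → Sub.mem? (centralizer-sub SH y) s ×-dec (s ↑ k ≟ᶠ ε))
    (λ s → h ∙ s ∙ h ⁻¹)
    (λ {s} ((Hs , sx) , sk) → (∙∈ (∙∈ Hh Hs) (⁻¹∈ Hh) , conj-commute hx≡yh sx) ,
      trans (conj-↑ s k) (trans (cong (λ z → h ∙ z ∙ h ⁻¹) sk) (trans (cong (_∙ h ⁻¹) (identityʳ h)) (inverseʳ h))))
    (λ {s} {t} _ _ e → ∙-cancelˡ h _ _ (∙-cancelʳ (h ⁻¹) _ _ e))
    λ {t} ((Ht , ty) , tk) → h ⁻¹ ∙ t ∙ h ,
      ((∙∈ (∙∈ (⁻¹∈ Hh) Ht) Hh , back-commute ty) , back-↑ tk) , undo t)
    where
    open Sub SH
    open ≡-Reasoning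
    conj-↑ : ∀ s k → (h ∙ s ∙ h ⁻¹) ↑ k ≡ h ∙ s ↑ k ∙ h ⁻¹
    conj-↑ s zero = trans (↑-0 _) (sym (trans (cong (λ z → h ∙ z ∙ h ⁻¹) (↑-0 s))
      (trans (cong (_∙ h ⁻¹) (identityʳ h)) (inverseʳ h))))
    conj-↑ s (suc k) = begin
      (h ∙ s ∙ h ⁻¹) ↑ suc k                   ≡⟨ ↑-suc _ k ⟩
      h ∙ s ∙ h ⁻¹ ∙ (h ∙ s ∙ h ⁻¹) ↑ k        ≡⟨ cong (_ ∙_) (conj-↑ s k) ⟩
      h ∙ s ∙ h ⁻¹ ∙ (h ∙ s ↑ k ∙ h ⁻¹)        ≡⟨ assoc _ (h ⁻¹) _ ⟩
      h ∙ s ∙ (h ⁻¹ ∙ (h ∙ s ↑ k ∙ h ⁻¹))      ≡⟨ cong (λ z → h ∙ s ∙ (h ⁻¹ ∙ z)) (assoc h _ _) ⟩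
      h ∙ s ∙ (h ⁻¹ ∙ (h ∙ (s ↑ k ∙ h ⁻¹)))    ≡⟨ cong (h ∙ s ∙_) (cancel-⁻¹∙ h _) ⟩
      h ∙ s ∙ (s ↑ k ∙ h ⁻¹)                   ≡⟨ assoc _ _ _ ⟨
      h ∙ s ∙ s ↑ k ∙ h ⁻¹                     ≡⟨ cong (_∙ h ⁻¹) (assoc h s _) ⟩
      h ∙ (s ∙ s ↑ k) ∙ h ⁻¹                   ≡⟨ cong (λ z → h ∙ z ∙ h ⁻¹) (↑-suc s k) ⟨
      h ∙ s ↑ suc k ∙ h ⁻¹                     ∎
    cancelʳ⁻¹ : ∀ z → z ∙ h ⁻¹ ∙ h ≡ z
    cancelʳ⁻¹ z = trans (assoc z _ h) (trans (cong (z ∙_) (inverseˡ h)) (identityʳ z))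
    conj-commute : h ∙ x ≡ y ∙ h → ∀ {s} → Commute s x → Commute (h ∙ s ∙ h ⁻¹) y
    conj-commute e {s} sx = ∙-cancelʳ h _ _ (begin
      h ∙ s ∙ h ⁻¹ ∙ y ∙ h          ≡⟨ assoc _ y h ⟩
      h ∙ s ∙ h ⁻¹ ∙ (y ∙ h)        ≡⟨ cong (h ∙ s ∙ h ⁻¹ ∙_) e ⟨
      h ∙ s ∙ h ⁻¹ ∙ (h ∙ x)        ≡⟨ assoc _ h x ⟨
      h ∙ s ∙ h ⁻¹ ∙ h ∙ x          ≡⟨ cong (_∙ x) (cancelʳ⁻¹ (h ∙ s)) ⟩
      h ∙ s ∙ x                     ≡⟨ assoc h s x ⟩
      h ∙ (s ∙ x)                   ≡⟨ cong (h ∙_) sx ⟩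
      h ∙ (x ∙ s)                   ≡⟨ assoc h x s ⟨
      h ∙ x ∙ s                     ≡⟨ cong (_∙ s) e ⟩
      y ∙ h ∙ s                     ≡⟨ assoc y h s ⟩
      y ∙ (h ∙ s)                   ≡⟨ cong (y ∙_) (cancelʳ⁻¹ (h ∙ s)) ⟨
      y ∙ (h ∙ s ∙ h ⁻¹ ∙ h)        ≡⟨ assoc y _ h ⟨
      y ∙ (h ∙ s ∙ h ⁻¹) ∙ h        ∎)
    undo : ∀ t → h ∙ (h ⁻¹ ∙ t ∙ h) ∙ h ⁻¹ ≡ t
    undo t = ∙-cancelʳ h _ _ (trans (cancelʳ⁻¹ _)
      (trans (cong (h ∙_) (assoc _ t h)) (cancel-∙⁻¹ h (t ∙ h))))
    back-commute : ∀ {t} → Commute t y → Commute (h ⁻¹ ∙ t ∙ h) x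
    back-commute {t} ty = ∙-cancelˡ h _ _ (begin
      h ∙ (h ⁻¹ ∙ t ∙ h ∙ x)      ≡⟨ cong (λ z → h ∙ (z ∙ x)) (assoc _ t h) ⟩
      h ∙ (h ⁻¹ ∙ (t ∙ h) ∙ x)    ≡⟨ cong (h ∙_) (assoc _ _ x) ⟩
      h ∙ (h ⁻¹ ∙ (t ∙ h ∙ x))    ≡⟨ cancel-∙⁻¹ h _ ⟩
      t ∙ h ∙ x                   ≡⟨ assoc t h x ⟩
      t ∙ (h ∙ x)                 ≡⟨ cong (t ∙_) hx≡yh ⟩
      t ∙ (y ∙ h)                 ≡⟨ assoc t y h ⟨
      t ∙ y ∙ h                   ≡⟨ cong (_∙ h) ty ⟩
      y ∙ t ∙ h                   ≡⟨ assoc y t h ⟩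
      y ∙ (t ∙ h)                 ≡⟨ cong (y ∙_) (cancel-∙⁻¹ h (t ∙ h)) ⟨
      y ∙ (h ∙ (h ⁻¹ ∙ (t ∙ h)))  ≡⟨ assoc y h _ ⟨
      y ∙ h ∙ (h ⁻¹ ∙ (t ∙ h))    ≡⟨ cong₂ _∙_ (sym hx≡yh) (sym (assoc _ t h)) ⟩
      h ∙ x ∙ (h ⁻¹ ∙ t ∙ h)      ≡⟨ assoc h x _ ⟩
      h ∙ (x ∙ (h ⁻¹ ∙ t ∙ h))    ∎)
    back-↑ : ∀ {t} → t ↑ k ≡ ε → (h ⁻¹ ∙ t ∙ h) ↑ k ≡ ε
    back-↑ {t} tk = ∙-cancelˡ h _ _ (∙-cancelʳ (h ⁻¹) _ _ (begin
      h ∙ (h ⁻¹ ∙ t ∙ h) ↑ k ∙ h ⁻¹    ≡⟨ conj-↑ _ k ⟨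
      (h ∙ (h ⁻¹ ∙ t ∙ h) ∙ h ⁻¹) ↑ k  ≡⟨ cong (_↑ k) (undo t) ⟩
      t ↑ k                            ≡⟨ tk ⟩
      ε                                ≡⟨ inverseʳ h ⟨
      h ∙ h ⁻¹                         ≡⟨ cong (_∙ h ⁻¹) (identityʳ h) ⟨
      h ∙ ε ∙ h ⁻¹                     ∎))

  0<n : 0 < n
  0<n = subst (0 <_) whole-order (Sub.order>0 whole-sub)

  -- Building W up by adjoining one element at a time, each step multiplies the order by a divisor of c.
  abelian-order : ∀ {q} → Prime q → ∀ {c} → ¬ q ∣ c → ∀ {W} (SW : Sub W) →
    (∀ {x y} → W x → W y → Commute x y) → (∀ {x} → W x → x ↑ c ≡ ε) → ¬ q ∣ Sub.order SW
  abelian-order {q} pq {c} q∤c {W} SW comm exponent =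
    <-rec (λ d → ∀ {K} (SK : Sub K) → (∀ {x} → K x → W x) → ¬ q ∣ Sub.order SK →
            Sub.order SW ∸ Sub.order SK ≡ d → ¬ q ∣ Sub.order SW) go _
      trivial-sub (λ { refl → Sub.ε∈ SW })
      (λ q∣ → contradiction (∣1⇒≡1 (subst (q ∣_) trivial-order q∣)) (>⇒≢ (prime>1 pq))) refl
    where
    go : ∀ d → (∀ {d′} → d′ < d → ∀ {K} (SK : Sub K) → (∀ {x} → K x → W x) → ¬ q ∣ Sub.order SK →
                  Sub.order SW ∸ Sub.order SK ≡ d′ → ¬ q ∣ Sub.order SW) →
         ∀ {K} (SK : Sub K) → (∀ {x} → K x → W x) → ¬ q ∣ Sub.order SK →
         Sub.order SW ∸ Sub.order SK ≡ d → ¬ q ∣ Sub.order SW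
    go d rec {K} SK K⊆W q∤K refl with Sub.order SK <? Sub.order SW
    ... | no K≮W = subst (λ o → ¬ q ∣ o)
      (≤-antisym (count-mono (Sub.mem? SK) (Sub.mem? SW) K⊆W) (≮⇒≥ K≮W)) q∤K
    ... | yes K<W with count-<⇒∃ (Sub.mem? SK) (Sub.mem? SW) K<W
    ...   | x , Wx , ¬Kx = rec (∸-monoʳ-< (count-⊂ (Sub.mem? SK) (Sub.mem? ext-sub) K⊆ext x∈ext ¬Kx)
                              (count-mono (Sub.mem? ext-sub) (Sub.mem? SW) ext⊆W))
        ext-sub ext⊆W q∤ext refl
      where
      open Extension SK x (λ {h} Kh → h , Kh , comm (K⊆W Kh) Wx)
      ext⊆W : ∀ {y} → Ext y → W y
      ext⊆W = ext-⊆ SW K⊆W Wx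
      q∤ext : ¬ q ∣ Sub.order ext-sub
      q∤ext q∣ with euclidsLemma index (Sub.order SK) pq (subst (q ∣_) ext-order q∣)
      ... | inj₁ q∣index = q∤c (∣-trans q∣index (index-∣ (subst K (sym (exponent Wx)) (Sub.ε∈ SK))))
      ... | inj₂ q∣K = q∤K q∣K

  module PrimeRoots {q} (pq : Prime q) {A c} (n≡ : n ≡ q ^ A * c) (q∤c : ¬ q ∣ c) where

    0<c : 0 < c
    0<c = ∣⇒>0 (subst (c ∣_) (sym n≡) (n∣m*n (q ^ A))) 0<n

    -- Orders of elements divide `n`, so `roots SH (q ^ A)` counts all elements of `H` of `q`-power
    -- order.
    Frobenius : ∀ {H} → Sub H → Set
    Frobenius SH = ∀ e → q ^ e ∣ Sub.order SH → q ^ e ∣ roots SH (q ^ A)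

    -- Induction on the order of `H`. Grouping `H` by `c`-parts `u` writes its order as a sum of
    -- root counts in centralizers. Each central `u` contributes the wanted `roots SH (q ^ A)`, and
    -- these `u` form an abelian group of order prime to `q`. The other `u` have smaller
    -- centralizers, so by induction their classes contribute multiples of `q ^ e`. Hence `q ^ e`
    -- divides the wanted number times one prime to `q`.
    frobenius : ∀ {H} (SH : Sub H) → Frobenius SH
    frobenius SH = <-rec (λ m → ∀ {H} (SH : Sub H) → Sub.order SH ≡ m → Frobenius SH) go _ SH refl
      where
      go : ∀ m → (∀ {m′} → m′ < m → ∀ {H} (SH : Sub H) → Sub.order SH ≡ m′ → Frobenius SH) →
           ∀ {H} (SH : Sub H) → Sub.order SH ≡ m → Frobenius SH
      go _ rec {H} SH refl e e∣H =
        coprime-divisor (prime^-∤⇒coprime e pq q∤central)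
          (∣m+n∣m⇒∣n (subst (q ^ e ∣_) (trans decomposition (+-comm _ noncentral-sum)) e∣H) e∣noncentral)
        where
        open Sub SH
        open CoprimeParts (prime^-∤⇒coprime A pq q∤c) (prime^>0 pq A) 0<c using (root?; roots-decomposition)
        w : Fin n → ℕ
        w u = roots (centralizer-sub SH u) (q ^ A)
        Central : Fin n → Set
        Central u = ∀ s → H s → Commute s u
        central? : ∀ u → Dec (Central u)
        central? u = all? λ s → mem? s →-dec (s ∙ u ≟ᶠ u ∙ s)
        W Y : Fin n → Set
        W u = (H u × u ↑ c ≡ ε) × Central u
        Y u = (H u × u ↑ c ≡ ε) × ¬ Central u
        Y? : ∀ u → Dec (Y u)
        Y? u = root? SH c u ×-dec ¬? (central? u)
        W-sub : Sub W
        W-sub = record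
          { mem? = λ u → root? SH c u ×-dec central? u
          ; ε∈ = (ε∈ , ε↑ c) , λ _ _ → sym commute-ε
          ; ∙∈ = λ { ((Hx , xc) , zx) ((Hy , yc) , zy) →
              (∙∈ Hx Hy , trans (∙-↑ c (zy _ Hx)) (trans (cong₂ _∙_ xc yc) (identityˡ ε))) ,
              λ s Hs → sym (commute-∙ (sym (zx s Hs)) (sym (zy s Hs))) } }
        q∤central : ¬ q ∣ Sub.order W-sub
        q∤central = abelian-order pq q∤c W-sub (λ ((Hx , _) , _) (_ , zy) → zy _ Hx) (proj₂ ∘ proj₁)
        noncentral-sum : ℕ
        noncentral-sum = sum λ u → χ (Y? u) * w u
        decomposition : order ≡ Sub.order W-sub * roots SH (q ^ A) + noncentral-sum
        decomposition = begin
          order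
            ≡⟨ count-cong mem? (root? SH (q ^ A * c))
                 (λ {x} Hx → Hx , subst (λ k → x ↑ k ≡ ε) n≡ (↑n x)) proj₁ ⟩
          roots SH (q ^ A * c)
            ≡⟨ roots-decomposition SH ⟩
          sum (λ u → χ (root? SH c u) * w u)
            ≡⟨ sum-cong (λ u → split (root? SH c u) (central? u) (w u)) ⟩
          sum (λ u → χ (Sub.mem? W-sub u) * w u + χ (Y? u) * w u)
            ≡⟨ sum-+ _ _ ⟩
          sum (λ u → χ (Sub.mem? W-sub u) * w u) + noncentral-sum
            ≡⟨ cong (_+ noncentral-sum) (sum-cong λ u → central-weight u (Sub.mem? W-sub u)) ⟩
          sum (λ u → χ (Sub.mem? W-sub u) * roots SH (q ^ A)) + noncentral-sum
            ≡⟨ cong (_+ noncentral-sum) (sum-*ʳ _ _) ⟨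
          sum (λ u → χ (Sub.mem? W-sub u)) * roots SH (q ^ A) + noncentral-sum
            ≡⟨ cong (λ z → z * roots SH (q ^ A) + noncentral-sum) (count≡sum (Sub.mem? W-sub)) ⟨
          Sub.order W-sub * roots SH (q ^ A) + noncentral-sum ∎
          where
          open ≡-Reasoning
          split : ∀ {P Q : Set} (P? : Dec P) (Q? : Dec Q) v →
                  χ P? * v ≡ χ (P? ×-dec Q?) * v + χ (P? ×-dec ¬? Q?) * v
          split (yes _) (yes _) v = sym (+-identityʳ (1 * v))
          split (yes _) (no _)  v = refl
          split (no _)  Q?      v = refl
          central-weight : ∀ u (W? : Dec (W u)) → χ W? * w u ≡ χ W? * roots SH (q ^ A)
          central-weight u (no _) = refl
          central-weight u (yes (_ , zu)) = cong (1 *_) (count-cong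
            (λ s → Sub.mem? (centralizer-sub SH u) s ×-dec (s ↑ (q ^ A) ≟ᶠ ε)) (root? SH (q ^ A))
            (λ ((Hs , _) , sk) → Hs , sk) (λ {s} (Hs , sk) → (Hs , zu s Hs) , sk))
        e∣noncentral : q ^ e ∣ noncentral-sum
        e∣noncentral = Conjugacy.class-sum-∣ SH Y?
          (λ Hh eqn ((Hx , xc) , ¬zx) → conj-root Hh eqn (Hx , xc) ,
            λ zy → ¬zx λ s Hs → conj-central Hh eqn zy s Hs)
          pq w
          (λ Hh eqn _ → roots-centralizer-conj SH (q ^ A) Hh eqn)
          (λ {x} (_ , ¬zx) → smaller ¬zx)
          e e∣H
          where
          conj-root : ∀ {h x y} → H h → h ∙ x ≡ y ∙ h → H x × x ↑ c ≡ ε → H y × y ↑ c ≡ ε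
          conj-root {h} {x} {y} Hh eqn (Hx , xc) = cancelʳ Hh (subst H eqn (∙∈ Hh Hx)) ,
            ∙-cancelʳ h _ _ (trans (sym (intertwine-↑ c eqn))
              (trans (cong (h ∙_) xc) (sym commute-ε)))
          conj-central : ∀ {h x y} → H h → h ∙ x ≡ y ∙ h → Central y → ∀ s → H s → Commute s x
          conj-central {h} {x} {y} Hh eqn zy s Hs = subst (Commute s) (∙-cancelˡ h _ _ (trans (zy h Hh) (sym eqn))) (zy s Hs)
          smaller : ∀ {x} → ¬ Central x → Frobenius (centralizer-sub SH x)
          smaller {x} ¬zx with any? (λ s → mem? s ×-dec ¬? (s ∙ x ≟ᶠ x ∙ s))
          ... | yes (s , Hs , ¬sx) = rec
            (count-⊂ (Sub.mem? (centralizer-sub SH x)) mem? proj₁ Hs (λ (_ , sx) → ¬sx sx))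
            (centralizer-sub SH x) refl
          ... | no ¬∃ = contradiction (λ s Hs → decide s Hs) ¬zx
            where
            decide : ∀ s → H s → Commute s x
            decide s Hs with s ∙ x ≟ᶠ x ∙ s
            ... | yes sx = sx
            ... | no ¬sx = contradiction (s , Hs , ¬sx) ¬∃

    -- The roots are grouped by their `l`-part, and `frobenius` is applied to each centralizer;
    -- summing over conjugacy classes recovers the power of `q` in `n`.
    frobenius-part : ∀ {l} → 0 < l → ¬ q ∣ l → ∀ e → q ^ e ∣ n → q ^ e ∣ roots whole-sub (q ^ A * l)
    frobenius-part {l} 0<l q∤l e e∣n =
      subst (q ^ e ∣_) (sym (roots-decomposition whole-sub))
        (Conjugacy.class-sum-∣ whole-sub (root? whole-sub l)
          (λ {h} _ eqn (_ , xl) → _ , ∙-cancelʳ h _ _ (trans (sym (intertwine-↑ l eqn))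
              (trans (cong (h ∙_) xl) (sym commute-ε))))
          pq (λ u → roots (centralizer-sub whole-sub u) (q ^ A))
          (λ _ eqn _ → roots-centralizer-conj whole-sub (q ^ A) _ eqn)
          (λ {x} _ → frobenius (centralizer-sub whole-sub x))
          e (subst (q ^ e ∣_) (sym whole-order) e∣n))
      where open CoprimeParts (prime^-∤⇒coprime A pq q∤l) (prime^>0 pq A) 0<l using (root?; roots-decomposition)

  -- Sylow subgroups

  prime-index : ∀ {K} (SK : Sub K) {x} (N : Normalizes x K) {p} → Prime p → K (x ↑ p) → ¬ K x →
                Extension.index SK x N ≡ p
  prime-index {K} SK {x} N pp Kxp ¬Kx with prime⇒irreducible pp (Extension.index-∣ SK x N Kxp)
  ... | inj₂ eqn = eqn
  ... | inj₁ eqn = contradiction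
    (subst K (trans (cong (x ↑_) eqn) (↑-1 x)) (Extension.↑index∈ SK x N)) ¬Kx

  module Normalizer {K} (SK : Sub K) where
    open Sub SK

    N : Fin n → Set
    N x = ∀ h → K h → ∃[ h′ ] (K h′ × h ∙ x ≡ x ∙ h′)

    normalizer-sub : Sub N
    normalizer-sub = record
      { mem? = λ x → all? λ h → mem? h →-dec any? λ h′ → mem? h′ ×-dec (h ∙ x ≟ᶠ x ∙ h′)
      ; ε∈ = λ h Kh → h , Kh , sym commute-ε
      ; ∙∈ = λ {x} {y} Nx Ny h Kh →
          let h′ , Kh′ , e₁ = Nx h Kh
              h″ , Kh″ , e₂ = Ny h′ Kh′
          in h″ , Kh″ , (begin
            h ∙ (x ∙ y)    ≡⟨ assoc h x y ⟨
            h ∙ x ∙ y      ≡⟨ cong (_∙ y) e₁ ⟩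
            x ∙ h′ ∙ y     ≡⟨ assoc x h′ y ⟩
            x ∙ (h′ ∙ y)   ≡⟨ cong (x ∙_) e₂ ⟩
            x ∙ (y ∙ h″)   ≡⟨ assoc x y h″ ⟨
            x ∙ y ∙ h″     ∎) }
      where open ≡-Reasoning

    K⊆N : ∀ {x} → K x → N x
    K⊆N {x} Kx h Kh = x ⁻¹ ∙ (h ∙ x) , ∙∈ (⁻¹∈ Kx) (∙∈ Kh Kx) , sym (cancel-∙⁻¹ x (h ∙ x))

    module _ {q} (pq : Prime q) {b} (order≡ : order ≡ q ^ b) where

      DoubleCoset : Fin n → Fin n → Set
      DoubleCoset x y = ¬ N x × ∃[ h ] (K h × Coset K (h ∙ x) y)

      _~?_ : ∀ x y → Dec (DoubleCoset x y)
      x ~? y = ¬? (Sub.mem? normalizer-sub x) ×-dec any? (λ h → mem? h ×-dec coset? SK (h ∙ x) y)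

      N-double : ∀ {x y h} → K h → Coset K (h ∙ x) y → N y → N x
      N-double {h = h} Kh (k , Kk , refl) Ny =
        Sub.cancelˡ normalizer-sub (K⊆N Kh) (Sub.cancelʳ normalizer-sub (K⊆N Kk) Ny)

      double-sym : ∀ {x y h} → K h → Coset K (h ∙ x) y → Coset K (h ⁻¹ ∙ y) x
      double-sym {x} {h = h} Kh (k , Kk , refl) = k ⁻¹ , ⁻¹∈ Kk , sym (begin
        h ⁻¹ ∙ (h ∙ x ∙ k) ∙ k ⁻¹   ≡⟨ cong (λ z → h ⁻¹ ∙ z ∙ k ⁻¹) (assoc h x k) ⟩
        h ⁻¹ ∙ (h ∙ (x ∙ k)) ∙ k ⁻¹ ≡⟨ cong (_∙ k ⁻¹) (cancel-⁻¹∙ h _) ⟩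
        x ∙ k ∙ k ⁻¹                ≡⟨ assoc x k _ ⟩
        x ∙ (k ∙ k ⁻¹)              ≡⟨ cong (x ∙_) (inverseʳ k) ⟩
        x ∙ ε                       ≡⟨ identityʳ x ⟩
        x                           ∎)
        where open ≡-Reasoning

      coset-∙ : ∀ g {a y} → Coset K a y → Coset K (g ∙ a) (g ∙ y)
      coset-∙ g {a} (k , Kk , refl) = k , Kk , sym (assoc g a k)

      double-trans : ∀ {g h x y z} → Coset K (h ∙ x) y → Coset K (g ∙ y) z → Coset K (g ∙ h ∙ x) z
      double-trans {g} {h} {x} {z = z} c d = subst (λ a → Coset K a z) (sym (assoc g h x))
        (coset-trans SK (coset-∙ g c) d)

      open Partition (λ x → ¬? (Sub.mem? normalizer-sub x)) _~?_ proj₁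
        (λ ¬Nx → ¬Nx , ε , ε∈ , subst (λ a → Coset K a _) (sym (identityˡ _)) (coset-refl SK))
        (λ (¬Nx , h , Kh , c) → ¬Nx ∘ N-double Kh c , h ⁻¹ , ⁻¹∈ Kh , double-sym Kh c)
        (λ (¬Nx , h , Kh , c) (_ , g , Kg , d) → ¬Nx , g ∙ h , ∙∈ Kg Kh , double-trans c d)

      module _ {x} (¬Nx : ¬ N x) where

        -- The intersection of `K` with `x K x⁻¹`, that is, the stabilizer of the coset `x K` under
        -- left multiplication by `K`.
        Stabilizer : Fin n → Set
        Stabilizer h = K h × Coset K x (h ∙ x)

        stabilizer? : ∀ h → Dec (Stabilizer h)
        stabilizer? h = mem? h ×-dec coset? SK x (h ∙ x)

        double-coset-order : order * order ≡ count (x ~?_) * count stabilizer?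
        double-coset-order = double-count mem? (x ~?_) (λ h y → mem? h ×-dec coset? SK (h ∙ x) y)
          (λ (Kh , c) → Kh , ¬Nx , _ , Kh , c)
          (λ {h} Kh → trans
            (count-cong (λ y → mem? h ×-dec coset? SK (h ∙ x) y) (coset? SK (h ∙ x)) proj₂ (Kh ,_))
            (coset-count SK (h ∙ x)))
          (λ {y} (_ , h , Kh , c) → sym (count-bij stabilizer? (λ g → mem? g ×-dec coset? SK (g ∙ x) y) (h ∙_)
            (λ {d} (Kd , cd) → ∙∈ Kh Kd , subst (λ a → Coset K a y) (sym (assoc h d x))
              (coset-trans SK (coset-∙ h (coset-sym SK cd)) c))
            (λ _ _ → ∙-cancelˡ h _ _)
            λ {g} (Kg , cg) → h ⁻¹ ∙ g ,
              (∙∈ (⁻¹∈ Kh) Kg , coset-sym SK (double-trans cg (double-sym Kh c))) ,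
              cancel-∙⁻¹ h g))

        stabilizer<order : count stabilizer? < q ^ b
        stabilizer<order = subst (count stabilizer? <_) order≡ (≰⇒> λ order≤ →
          ¬Nx λ h Kh → let k , Kk , eqn = proj₂ (count-≥⇒⊇ stabilizer? mem? proj₁ order≤ Kh) in k , Kk , eqn)

        double-coset-∣ : q ^ suc b ∣ count (x ~?_)
        -- As a divisor of `order * order` the stabilizer has `q`-power size. This size is less than
        -- `q ^ b`, which leaves at least `suc b` factors `q` to the double coset.
        double-coset-∣ with ∣-prime^ pq (b + b) {count stabilizer?}
          (subst (count stabilizer? ∣_)
            (trans (sym double-coset-order) (trans (cong₂ _*_ order≡ order≡) (sym (^-distribˡ-+-* q b b))))
            (n∣m*n (count (x ~?_))))
        ... | i , i≤ , eqn = subst (q ^ suc b ∣_) (sym size) (^-mono-∣ q suc-b≤)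
          where
          instance
            q≢0 : NonZero q
            q≢0 = prime⇒nonZero pq
            qi≢0 : NonZero (q ^ i)
            qi≢0 = m^n≢0 q i
          i<b : i < b
          i<b = ≰⇒> λ b≤i → <⇒≱ (subst (_< q ^ b) eqn stabilizer<order) (^-monoʳ-≤ q b≤i)
          size : count (x ~?_) ≡ q ^ (b + b ∸ i)
          size = *-cancelʳ-≡ _ _ (q ^ i) (begin
            count (x ~?_) * q ^ i              ≡⟨ cong (count (x ~?_) *_) eqn ⟨
            count (x ~?_) * count stabilizer?  ≡⟨ double-coset-order ⟨
            order * order                      ≡⟨ cong₂ _*_ order≡ order≡ ⟩
            q ^ b * q ^ b                      ≡⟨ ^-distribˡ-+-* q b b ⟨
            q ^ (b + b)                        ≡⟨ cong (q ^_) (m∸n+n≡m i≤) ⟨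
            q ^ (b + b ∸ i + i)                ≡⟨ ^-distribˡ-+-* q (b + b ∸ i) i ⟩
            q ^ (b + b ∸ i) * q ^ i            ∎)
            where open ≡-Reasoning
          suc-b≤ : suc b ≤ b + b ∸ i
          suc-b≤ = subst (suc b ≤_) (sym (+-∸-assoc b (<⇒≤ i<b)))
            (m<m+n b (m<n⇒0<n∸m i<b))

      -- The complement of the normalizer is a union of double cosets, so its size is a multiple of
      -- `q ^ suc b`, as is `n`.
      normalizer-∣ : q ^ suc b ∣ n → q ^ suc b ∣ Sub.order normalizer-sub
      normalizer-∣ q∣n = ∣m+n∣m⇒∣n
        (subst (q ^ suc b ∣_) (sym (trans (+-comm _ (Sub.order normalizer-sub)) split)) q∣n)
        (count-partition-∣ (λ ¬Nx → double-coset-∣ ¬Nx))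
        where
        split : Sub.order normalizer-sub + count (λ x → ¬? (Sub.mem? normalizer-sub x)) ≡ n
        split = trans (cong₂ _+_
            (count-cong _ (λ x → yes _ ×-dec Sub.mem? normalizer-sub x) (_ ,_) proj₂)
            (count-cong _ (λ x → yes _ ×-dec ¬? (Sub.mem? normalizer-sub x)) (_ ,_) proj₂))
          (trans (sym (count-split (Sub.mem? whole-sub) (Sub.mem? normalizer-sub))) whole-order)

  module PrimeSubgroups {q} (pq : Prime q) {A c} (n≡ : n ≡ q ^ A * c) (q∤c : ¬ q ∣ c) where
    open PrimeRoots pq {A} {c} n≡ q∤c using (frobenius)

    module _ {P} (SP : Sub P) {b} (order≡ : Sub.order SP ≡ q ^ b) (b<A : b < A) where
      open Normalizer SP
      private module N = Sub normalizer-sub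

      -- By `frobenius` the number of elements of `q`-power order in the normalizer is a positive
      -- multiple of `q ^ suc b`, more than `P` can hold. This takes the place of Cauchy's theorem
      -- in the quotient by `P`.
      new-normalizing-root : ∃[ s ] ((N s × s ↑ (q ^ A) ≡ ε) × ¬ P s)
      new-normalizing-root = count-<⇒∃ (Sub.mem? SP) root? (subst (_< count root?) (sym order≡) (<-≤-trans
        (^-monoʳ-< q (prime>1 pq) (n<1+n b))
        (∣⇒≤ {{>-nonZero (count>0 root? (N.ε∈ , ε↑ (q ^ A)))}} divisible)))
        where
        root? : ∀ s → Dec (N s × s ↑ (q ^ A) ≡ ε)
        root? s = N.mem? s ×-dec (s ↑ (q ^ A) ≟ᶠ ε)
        divisible : q ^ suc b ∣ roots normalizer-sub (q ^ A)
        divisible = frobenius normalizer-sub (suc b) (normalizer-∣ pq {b} order≡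
          (subst (q ^ suc b ∣_) (sym n≡) (∣m⇒∣m*n c (^-mono-∣ q b<A))))

      -- The relative order of `s` is a power of `q`, so some power of `s` lies outside `P` while
      -- its `q`-th power lies inside. Adjoining that power multiplies the order by exactly `q`.
      extend-by-root : ∀ {s} → N s → s ↑ (q ^ A) ≡ ε → ¬ P s → ∃[ Q ] Σ[ SQ ∈ Sub Q ] Sub.order SQ ≡ q ^ suc b
      extend-by-root {s} Ns sA ¬Ps with ∣-prime^ pq A (index-∣ (subst P (sym sA) (Sub.ε∈ SP)))
        where open Extension SP s (Ns _)
      ... | zero , _ , eqn = contradiction
        (subst P (trans (cong (s ↑_) eqn) (↑-1 s)) (Extension.↑index∈ SP s (Ns _))) ¬Ps
      ... | suc i , _ , eqn = Ext , ext-sub ,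
        trans ext-order (cong₂ _*_ (prime-index SP normalizes pq Pxq ¬Px) order≡)
        where
        x : Fin n
        x = s ↑ (q ^ i)
        normalizes : Normalizes x P
        normalizes = normalizes-↑ (Ns _) (q ^ i)
        Pxq : P (x ↑ q)
        Pxq = subst P (trans (cong (s ↑_) eqn) (↑-* s q (q ^ i))) (Extension.↑index∈ SP s (Ns _))
        ¬Px : ¬ P x
        ¬Px Px = <⇒≱ (^-monoʳ-< q (prime>1 pq) (n<1+n i))
          (subst (_≤ q ^ i) eqn (∣⇒≤ {{m^n≢0 q i {{prime⇒nonZero pq}}}} (Extension.index-∣ SP s (Ns _) Px)))
        open Extension SP x normalizes

    sylow : ∀ b → b ≤ A → ∃[ P ] Σ[ SP ∈ Sub P ] Sub.order SP ≡ q ^ b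
    sylow zero _ = Trivial , trivial-sub , trivial-order
    sylow (suc b) b<A =
      let P , SP , order≡ = sylow b (<⇒≤ b<A)
          s , (Ns , sA) , ¬Ps = new-normalizing-root SP {b} order≡ b<A
      in extend-by-root SP {b} order≡ b<A Ns sA ¬Ps

    ∣tabulate∣ : ∀ {m} {P : Fin m → Set} (P? : ∀ x → Dec (P x)) → ∣ tabulate (does ∘ P?) ∣ ≡ count P?
    ∣tabulate∣ {zero}  P? = sym (count-[] P?)
    ∣tabulate∣ {suc m} P? = trans (split (P? zero)) (sym (count-∷ P?))
      where
      split : {A : Set} (A? : Dec A) → ∣ does A? Vec.∷ tabulate (does ∘ P? ∘ suc) ∣ ≡ χ A? + count (P? ∘ suc)
      split (yes _) = cong suc (∣tabulate∣ (P? ∘ suc))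
      split (no _)  = ∣tabulate∣ (P? ∘ suc)

    module _ {P : Fin n → Set} (P? : ∀ x → Dec (P x)) where

      to-∈ : ∀ {x} → P x → x ∈ˢ tabulate (does ∘ P?)
      to-∈ {x} Px = lookup⇒[]= x _ (trans (lookup∘tabulate _ x) (true-of (P? x)))
        where
        true-of : (D : Dec (P x)) → does D ≡ inside
        true-of (yes _)  = refl
        true-of (no ¬Px) = contradiction Px ¬Px

      from-∈ : ∀ {x} → x ∈ˢ tabulate (does ∘ P?) → P x
      from-∈ {x} x∈ = of-true (P? x) (trans (sym (lookup∘tabulate _ x)) ([]=⇒lookup x∈))
        where
        of-true : (D : Dec (P x)) → does D ≡ inside → P x
        of-true (yes Px) _ = Px

    -- The assumption that Sylow subgroups are cyclic enters the proof here only.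
    full-order : IsZGroup G → ∃[ g ] ord g ≡ q ^ A
    full-order Z with sylow A ≤-refl
    ... | P , SP , order≡ with Z q pq (tabulate (does ∘ mem?)) (record
        { isSubgroup = record
          { ∙-closed = λ x∈ y∈ → to-∈ mem? (∙∈ (from-∈ mem? x∈) (from-∈ mem? y∈))
          ; ε-closed = to-∈ mem? ε∈
          ; ⁻¹-closed = λ x∈ → to-∈ mem? (⁻¹∈ (from-∈ mem? x∈)) }
        ; exponent = A
        ; order = trans (∣tabulate∣ mem?) order≡
        ; divides = subst (q ^ A ∣_) (sym n≡) (m∣m*n c)
        ; maximal = λ d → q∤c (*-cancelˡ-∣ (q ^ A) {{m^n≢0 q A {{prime⇒nonZero pq}}}}
            (subst (q ^ A * q ∣_) n≡ (subst (_∣ n) (*-comm q (q ^ A)) d))) })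
      where open Sub SP
    ...   | g , g∈ , generates = g , trans (sym (⟨⟩-order g)) (trans
      (count-cong (Sub.mem? (⟨⟩-sub g)) mem? (⟨⟩-⊆ SP (from-∈ mem? g∈))
        λ Px → let k , eqn = generates _ (to-∈ mem? Px) in subst ⟨ g ⟩ (sym eqn) (zpower k))
      order≡)
      where
      open Sub SP
      zpower : ∀ k → ⟨ g ⟩ (FiniteGroup._^ᶻ_ G g k)
      zpower (ℤ.+ k)    = subst ⟨ g ⟩ (↑≡power g k) (⟨⟩-intro g k)
      zpower ℤ.-[1+ k ] = Sub.⁻¹∈ (⟨⟩-sub g) (subst ⟨ g ⟩ (↑≡power g (suc k)) (⟨⟩-intro g (suc k)))

  -- Elements of exact prime-power order

  module ExactOrder {q} (pq : Prime q) (b : ℕ) where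

    private instance
      q≢0 : NonZero q
      q≢0 = prime⇒nonZero pq
      qb≢0 : NonZero (q ^ b)
      qb≢0 = m^n≢0 q b

    Exact : Fin n → Set
    Exact s = s ↑ (q ^ suc b) ≡ ε × ¬ s ↑ (q ^ b) ≡ ε

    exact? : ∀ s → Dec (Exact s)
    exact? s = (s ↑ (q ^ suc b) ≟ᶠ ε) ×-dec ¬? (s ↑ (q ^ b) ≟ᶠ ε)

    exact-ord : ∀ {s} → Exact s → ord s ≡ q ^ suc b
    exact-ord {s} (e , ¬e) with ∣-prime^ pq (suc b) (ord-∣ s e)
    ... | i , i≤ , eqn with m≤n⇒m<n∨m≡n i≤
    ...   | inj₂ refl = eqn
    ...   | inj₁ (s≤s i≤b) = contradiction
      (↑-∣ (↑ord s) (subst (_∣ q ^ b) (sym eqn) (^-mono-∣ q i≤b))) ¬e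

    nonexact-generator : ∀ {s} → Exact s → ord (s ↑ q) ≡ q ^ b
    nonexact-generator {s} es@(e , _) = ∣-antisym
      (ord-∣ (s ↑ q) (trans (sym (↑-*′ s q (q ^ b))) e))
      (*-cancelˡ-∣ q (subst (_∣ q * ord (s ↑ q)) (exact-ord es)
        (ord-∣ s (trans (↑-*′ s q _) (↑ord (s ↑ q))))))

    ⟨⟩-sym : ∀ {x y} → Exact x → Exact y → ⟨ x ⟩ y → ⟨ y ⟩ x
    ⟨⟩-sym {x} {y} ex ey y∈ = count-≥⇒⊇ (Sub.mem? (⟨⟩-sub y)) (Sub.mem? (⟨⟩-sub x)) (⟨⟩-⊆ (⟨⟩-sub x) y∈)
      (≤-reflexive (trans (⟨⟩-order x) (trans (exact-ord ex) (sym (trans (⟨⟩-order y) (exact-ord ey))))))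
      (x∈⟨x⟩ x)

    nonexact : ∀ {x y} → Exact x → ⟨ x ⟩ y → ¬ Exact y → ⟨ x ↑ q ⟩ y
    nonexact {x} {y} ex y∈ ¬ey with ⟨⟩-elim y∈
    ... | k , _ , refl with (x ↑ k) ↑ (q ^ b) ≟ᶠ ε
    ...   | no ¬e = contradiction (xk , ¬e) ¬ey
      where
      xk : (x ↑ k) ↑ (q ^ suc b) ≡ ε
      xk = trans (sym (↑-*′ x k _)) (↑-∣ (proj₁ ex) (n∣m*n k))
    ...   | yes e with *-cancelʳ-∣ {m = q} {n = k} (q ^ b) (subst (_∣ k * q ^ b) (exact-ord ex) (ord-∣ x (trans (↑-*′ x k _) e)))
    ...     | divides j refl = subst ⟨ x ↑ q ⟩ (sym (↑-* x j q)) (⟨⟩-intro (x ↑ q) j)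

    module _ {H} (SH : Sub H) where
      open Sub SH

      E : Fin n → Set
      E s = H s × Exact s

      E? : ∀ s → Dec (E s)
      E? s = mem? s ×-dec exact? s

      _~?_ : ∀ x y → Dec (E x × Exact y × ⟨ x ⟩ y)
      x ~? y = E? x ×-dec (exact? y ×-dec Sub.mem? (⟨⟩-sub x) y)

      open Partition E? _~?_ proj₁ (λ {x} (Hx , ex) → (Hx , ex) , ex , x∈⟨x⟩ x)
        (λ ((Hx , ex) , ey , y∈) → (⟨⟩-⊆ SH Hx y∈ , ey) , ex , ⟨⟩-sym ex ey y∈)
        (λ {x} (Ex , _ , y∈) (_ , ez , z∈) → Ex , ez , ⟨⟩-⊆ (⟨⟩-sub x) y∈ z∈)

      -- The class of `x` consists of the generators of `⟨ x ⟩`. The other elements of `⟨ x ⟩` form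
      -- `⟨ x ↑ q ⟩`, which has `q ^ b` elements.
      class-count : ∀ {x} → E x → count (x ~?_) + q ^ b ≡ q * q ^ b
      class-count {x} (Hx , ex) = sym (begin
        q * q ^ b
          ≡⟨ exact-ord ex ⟨
        ord x
          ≡⟨ ⟨⟩-order x ⟨
        Sub.order (⟨⟩-sub x)
          ≡⟨ count-split (Sub.mem? (⟨⟩-sub x)) exact? ⟩
        count (λ y → Sub.mem? (⟨⟩-sub x) y ×-dec exact? y) + count (λ y → Sub.mem? (⟨⟩-sub x) y ×-dec ¬? (exact? y))
          ≡⟨ cong₂ _+_
               (count-cong _ (x ~?_) (λ (y∈ , ey) → (Hx , ex) , ey , y∈) (λ (_ , ey , y∈) → y∈ , ey))
               (count-cong _ (Sub.mem? (⟨⟩-sub (x ↑ q))) (λ (y∈ , ¬ey) → nonexact ex y∈ ¬ey)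
                 (λ y∈ → ⟨⟩-⊆ (⟨⟩-sub x) (⟨⟩-intro x q) y∈ ,
                   λ (_ , ¬e) → ¬e (↑-∣ (↑-order (⟨⟩-sub (x ↑ q)) y∈)
                     (∣-reflexive (trans (⟨⟩-order (x ↑ q)) (nonexact-generator ex)))))) ⟩
        count (x ~?_) + Sub.order (⟨⟩-sub (x ↑ q))
          ≡⟨ cong (count (x ~?_) +_) (trans (⟨⟩-order (x ↑ q)) (nonexact-generator ex)) ⟩
        count (x ~?_) + q ^ b ∎)
        where open ≡-Reasoning

      class-count′ : ∀ {x} → E x → count (x ~?_) ≡ (q ∸ 1) * q ^ b
      class-count′ {x} Ex = begin
        count (x ~?_)                     ≡⟨ m+n∸n≡m _ (q ^ b) ⟨
        count (x ~?_) + q ^ b ∸ q ^ b     ≡⟨ cong (_∸ q ^ b) (class-count Ex) ⟩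
        q * q ^ b ∸ q ^ b                 ≡⟨ cong (q * q ^ b ∸_) (*-identityˡ (q ^ b)) ⟨
        q * q ^ b ∸ 1 * q ^ b             ≡⟨ *-distribʳ-∸ (q ^ b) q 1 ⟨
        (q ∸ 1) * q ^ b                   ∎
        where open ≡-Reasoning

      exact-count-∣ : (q ∸ 1) * q ^ b ∣ count E?
      exact-count-∣ = count-partition-∣ λ Ex → ∣-reflexive (sym (class-count′ Ex))

      exact-roots : roots SH (q ^ suc b) ≡ roots SH (q ^ b) + count E?
      exact-roots = trans (count-split (λ s → mem? s ×-dec (s ↑ (q ^ suc b) ≟ᶠ ε)) (λ s → s ↑ (q ^ b) ≟ᶠ ε))
        (cong₂ _+_
          (count-cong _ (λ s → mem? s ×-dec (s ↑ (q ^ b) ≟ᶠ ε)) (λ ((Hs , _) , e) → Hs , e)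
            (λ (Hs , e) → (Hs , ↑-∣ e (n∣m*n q)) , e))
          (count-cong _ E? (λ ((Hs , e) , ¬e) → Hs , e , ¬e) (λ (Hs , e , ¬e) → (Hs , e) , ¬e)))

    -- Both root counts are grouped by the same `m`-parts `u`. Over `u`, the new roots correspond to
    -- the elements of exact order `q ^ suc b` in the centralizer of `u`.
    roots-step : ∀ {m} → 0 < m → ¬ q ∣ m → ∃[ X ]
      (roots whole-sub (q ^ suc b * m) ≡ roots whole-sub (q ^ b * m) + X × (q ∸ 1) * q ^ b ∣ X)
    roots-step {m} 0<m q∤m = X , eqn , sum-∣ λ u → ∣n⇒∣m*n (χ (whole-root? u)) (exact-count-∣ (C u))
      where
      open ≡-Reasoning
      module Suc = CoprimeParts (prime^-∤⇒coprime (suc b) pq q∤m) (prime^>0 pq (suc b)) 0<m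
      module Same = CoprimeParts (prime^-∤⇒coprime b pq q∤m) (prime^>0 pq b) 0<m
      whole-root? : ∀ u → Dec (⊤ × u ↑ m ≡ ε)
      whole-root? = Same.root? whole-sub m
      C : ∀ u → Sub (Centralizer (λ _ → ⊤) u)
      C = centralizer-sub whole-sub
      X : ℕ
      X = sum λ u → χ (whole-root? u) * count (E? (C u))
      eqn : roots whole-sub (q ^ suc b * m) ≡ roots whole-sub (q ^ b * m) + X
      eqn = begin
        roots whole-sub (q ^ suc b * m)
          ≡⟨ Suc.roots-decomposition whole-sub ⟩
        sum (λ u → χ (whole-root? u) * roots (C u) (q ^ suc b))
          ≡⟨ sum-cong (λ u → trans (cong (χ (whole-root? u) *_) (exact-roots (C u)))
               (*-distribˡ-+ (χ (whole-root? u)) _ _)) ⟩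
        sum (λ u → χ (whole-root? u) * roots (C u) (q ^ b) + χ (whole-root? u) * count (E? (C u)))
          ≡⟨ sum-+ _ _ ⟩
        sum (λ u → χ (whole-root? u) * roots (C u) (q ^ b)) + X
          ≡⟨ cong (_+ X) (Same.roots-decomposition whole-sub) ⟨
        roots whole-sub (q ^ b * m) + X ∎

  -- The chain of divisors

  RootCount : ℕ → Set
  RootCount d = roots whole-sub d ≡ d

  -- d is obtained from n by repeatedly removing the smallest prime factor.
  UpperPart : ℕ → ℕ → Set
  UpperPart d r = n ≡ d * r × (∀ {p q} → Prime p → Prime q → p ∣ r → q ∣ d → p ≤ q)

  module Descent (Z : IsZGroup G) {d r} (root-count : RootCount d) (upper : UpperPart d r)
    {p} (pp : Prime p) (p-least : ∀ {q} → Prime q → q ∣ d → p ≤ q)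
    {b m} (d≡ : d ≡ p ^ suc b * m) (p∤m : ¬ p ∣ m) where

    d′ : ℕ
    d′ = p ^ b * m

    d≡pd′ : d ≡ p * d′
    d≡pd′ = trans d≡ (*-assoc p (p ^ b) m)

    d′∣d : d′ ∣ d
    d′∣d = subst (d′ ∣_) (sym d≡pd′) (n∣m*n p)

    n≡d′pr : n ≡ d′ * (p * r)
    n≡d′pr = begin
      n              ≡⟨ proj₁ upper ⟩
      d * r          ≡⟨ cong (_* r) (trans d≡pd′ (*-comm p d′)) ⟩
      d′ * p * r     ≡⟨ *-assoc d′ p r ⟩
      d′ * (p * r)   ∎
      where open ≡-Reasoning

    d′∣n : d′ ∣ n
    d′∣n = subst (d′ ∣_) (sym n≡d′pr) (m∣m*n (p * r))

    0<d′ : 0 < d′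
    0<d′ = ∣⇒>0 d′∣n 0<n

    instance
      p≢0 : NonZero p
      p≢0 = prime⇒nonZero pp
      d′≢0 : NonZero d′
      d′≢0 = >-nonZero 0<d′

    0<m : 0 < m
    0<m = ∣⇒>0 (n∣m*n (p ^ b)) 0<d′

    d′<d : d′ < d
    d′<d = subst (d′ <_) (trans (*-comm d′ p) (sym d≡pd′)) (m<m*n d′ p (prime>1 pp))

    upper′ : UpperPart d′ (p * r)
    upper′ = n≡d′pr , least′
      where
      least′ : ∀ {p′ q} → Prime p′ → Prime q → p′ ∣ p * r → q ∣ d′ → p′ ≤ q
      least′ {p′} pp′ pq p′∣pr q∣d′ with euclidsLemma p r pp′ p′∣pr
      ... | inj₁ p′∣p = ≤-trans (∣⇒≤ p′∣p) (p-least pq (∣-trans q∣d′ d′∣d))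
      ... | inj₂ p′∣r = proj₂ upper pp′ pq p′∣r (∣-trans q∣d′ d′∣d)

    f : ℕ
    f = roots whole-sub d′

    private
      step = ExactOrder.roots-step pp b 0<m p∤m

    X : ℕ
    X = proj₁ step

    d≡f+X : d ≡ f + X
    d≡f+X = trans (sym root-count) (trans (cong (roots whole-sub) d≡) (proj₁ (proj₂ step)))

    X-∣ : (p ∸ 1) * p ^ b ∣ X
    X-∣ = proj₂ (proj₂ step)

    -- Checked prime by prime: at `p` by subtracting `X` from `d`, both multiples of `p ^ b`; at any
    -- other prime factor of `d′` by `frobenius-part`.
    d′∣f : d′ ∣ f
    d′∣f = ∣-from-prime-powers d′ 0<d′ local
      where
      local-p : ∀ e → p ^ e ∣ d′ → p ^ e ∣ f
      local-p e pe∣ = ∣-trans (∣-prime-part pp b e p∤m pe∣)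
        (∣m+n∣m⇒∣n (subst (p ^ b ∣_) (trans d≡f+X (+-comm f X)) (subst (p ^ b ∣_) (sym d≡) (∣m⇒∣m*n m (n∣m*n p))))
          (∣-trans (n∣m*n (p ∸ 1)) X-∣))
      local-q : ∀ {q} → Prime q → q ∣ d′ → q ≢ p → ∀ e → q ^ e ∣ d′ → q ^ e ∣ f
      local-q {q} pq q∣d′ q≢p e qe∣ with prime-part pq d′ 0<d′
      ... | a , l , d′≡ , q∤l = subst (λ z → q ^ e ∣ roots whole-sub z) (sym d′≡)
        (PrimeRoots.frobenius-part pq {a} {l * (p * r)}
          (trans n≡d′pr (trans (cong (_* (p * r)) d′≡) (*-assoc (q ^ a) l (p * r)))) q∤c
          (∣⇒>0 (subst (l ∣_) (sym d′≡) (n∣m*n (q ^ a))) 0<d′) q∤l e (∣-trans qe∣ d′∣n))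
        where
        -- A prime `q` dividing `p * r` would be at most `p`, hence equal to the least prime factor
        -- `p` of `d`.
        q∤c : ¬ q ∣ l * (p * r)
        q∤c q∣c with euclidsLemma l (p * r) pq q∣c
        ... | inj₁ q∣l = q∤l q∣l
        ... | inj₂ q∣pr = q≢p (≤-antisym q≤p (p-least pq (∣-trans q∣d′ d′∣d)))
          where
          q≤p : q ≤ p
          q≤p with euclidsLemma p r pq q∣pr
          ... | inj₁ q∣p = ∣⇒≤ q∣p
          ... | inj₂ q∣r = proj₂ upper pq pp q∣r (subst (p ∣_) (sym d≡pd′) (m∣m*n d′))
      local : ∀ {q} → Prime q → ∀ e → q ^ e ∣ d′ → q ^ e ∣ f
      local {q} pq e qe∣ with q ≟ p | q ∣? d′
      ... | yes refl | _ = local-p e qe∣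
      ... | no q≢p | yes q∣d′ = local-q pq q∣d′ q≢p e qe∣
      local {q} pq zero    qe∣ | no _ | no _ = 1∣ f
      local {q} pq (suc e) qe∣ | no _ | no q∤d′ = contradiction (∣-trans (m∣m*n (q ^ e)) qe∣) q∤d′

    -- A generator of a Sylow p-subgroup has a power which is a root for d but not for d′.
    module _ {A c g} (n≡ : n ≡ p ^ A * c) (p∤c : ¬ p ∣ c) (ord-g : ord g ≡ p ^ A) where

      b<A : suc b ≤ A
      b<A = ^-∣⇒≤ pp (suc b) A (∣-prime-part pp A (suc b) p∤c (subst (p ^ suc b ∣_) (trans (sym (proj₁ upper)) n≡)
        (subst (λ z → p ^ suc b ∣ z * r) (sym d≡) (∣m⇒∣m*n r (m∣m*n m)))))
      s : Fin n
      s = g ↑ (p ^ (A ∸ suc b))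
      sb : s ↑ (p ^ suc b) ≡ ε
      sb = trans (sym (↑-*′ g _ (p ^ suc b)))
        (trans (cong (g ↑_) (trans (sym (^-distribˡ-+-* p (A ∸ suc b) (suc b))) (cong (p ^_) (m∸n+n≡m b<A))))
          (subst (λ o → g ↑ o ≡ ε) ord-g (↑ord g)))
      ord-g-∣ : s ↑ (p ^ b) ≡ ε → p ^ A ∣ p ^ (A ∸ suc b + b)
      ord-g-∣ e = subst (_∣ p ^ (A ∸ suc b + b)) ord-g (ord-∣ g (trans
        (cong (g ↑_) (^-distribˡ-+-* p (A ∸ suc b) b)) (trans (↑-*′ g (p ^ (A ∸ suc b)) (p ^ b)) e)))

      s-exact : ¬ s ↑ (p ^ b) ≡ ε
      s-exact e = <⇒≱ (+-monoʳ-< (A ∸ suc b) (n<1+n b)) (subst (_≤ A ∸ suc b + b) (sym (m∸n+n≡m b<A))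
        (^-∣⇒≤ pp A (A ∸ suc b + b) (ord-g-∣ e)))

      s-new : s ↑ d ≡ ε × ¬ s ↑ d′ ≡ ε
      s-new = ↑-∣ sb (subst (p ^ suc b ∣_) (sym d≡) (m∣m*n m)) , λ sd′ →
        let i , _ , ord-s = ∣-prime^ pp (suc b) (ord-∣ s sb)
        in s-exact (↑-∣ (↑ord s) (subst (_∣ p ^ b) (sym ord-s)
             (∣-prime-part pp b i p∤m (subst (_∣ d′) ord-s (ord-∣ s sd′)))))

    new-root : ∃[ s ] (s ↑ d ≡ ε × ¬ s ↑ d′ ≡ ε)
    new-root =
      let A , c , n≡ , p∤c = prime-part pp n 0<n
          g , ord-g = PrimeSubgroups.full-order pp {A} {c} n≡ p∤c Z
      in _ , s-new {A} {c} {g} n≡ p∤c ord-g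

    root-count′ : RootCount d′
    root-count′ = conclude d′∣f
      where
      root? : ∀ k x → Dec (⊤ × x ↑ k ≡ ε)
      root? k x = yes _ ×-dec (x ↑ k ≟ᶠ ε)
      0<f : 0 < f
      0<f = count>0 (root? d′) (_ , ε↑ d′)
      f<d : f < d
      f<d = subst (f <_) root-count (count-⊂ (root? d′) (root? d) (λ (_ , e) → _ , ↑-∣ e d′∣d)
        (_ , proj₁ (proj₂ new-root)) (λ (_ , e) → proj₂ (proj₂ new-root) e))
      co : Coprime (p ∸ 1) d′
      co {zero}  (g∣p , g∣d′) = contradiction (0∣⇒≡0 g∣d′) (>⇒≢ 0<d′)
      co {suc zero} _ = refl
      co {g@(suc (suc _))} (g∣p , g∣d′) with least-prime-factor {g} (s≤s z<s)
      ... | q , pq , q∣g , _ = contradiction (p-least pq (∣-trans q∣g (∣-trans g∣d′ d′∣d)))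
        (<⇒≱ (≤-<-trans (∣⇒≤ {{>-nonZero (m<n⇒0<n∸m (prime>1 pp))}} (∣-trans q∣g g∣p))
          (∸-monoʳ-< {p} z<s (<⇒≤ (prime>1 pp)))))
      conclude : d′ ∣ f → f ≡ d′
      conclude (divides k f≡) = trans f≡ (trans (cong (_* d′) k≡1) (*-identityˡ d′))
        where
        -- The element from `new-root` makes the inclusion of the two root sets strict. This
        -- excludes `k = p`, which the divisibilities alone would allow.
        k<p : k < p
        k<p = *-cancelʳ-< d′ k p (subst₂ _<_ f≡ d≡pd′ f<d)
        0<k : 0 < k
        0<k = ∣⇒>0 (divides d′ (trans f≡ (*-comm k d′))) 0<f
        X≡ : X ≡ d′ * (p ∸ k)
        X≡ = begin
          X                  ≡⟨ m+n∸m≡n f X ⟨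
          f + X ∸ f          ≡⟨ cong₂ _∸_ (trans (sym d≡f+X) d≡pd′) f≡ ⟩
          p * d′ ∸ k * d′    ≡⟨ *-distribʳ-∸ d′ p k ⟨
          (p ∸ k) * d′       ≡⟨ *-comm (p ∸ k) d′ ⟩
          d′ * (p ∸ k)       ∎
          where open ≡-Reasoning
        p-1≤ : p ∸ 1 ≤ p ∸ k
        p-1≤ = ∣⇒≤ {{>-nonZero (m<n⇒0<n∸m k<p)}}
          (coprime-divisor co (subst (p ∸ 1 ∣_) X≡ (∣-trans (m∣m*n (p ^ b)) X-∣)))
        k≡1 : k ≡ 1
        k≡1 = ≤-antisym (≮⇒≥ λ 1<k → <⇒≱ (∸-monoʳ-< 1<k (<⇒≤ k<p)) p-1≤) 0<k

  -- Self-centralizing cyclic normal subgroups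

  Root : ℕ → Fin n → Set
  Root d x = x ↑ d ≡ ε

  root-conj : ∀ {d g h h′} → h ∙ g ≡ g ∙ h′ → Root d h → Root d h′
  root-conj {d} {g} eqn hd = ∙-cancelˡ g _ _
    (trans (intertwine-↑ d (sym eqn)) (trans (cong (_∙ g) hd) commute-ε))

  conj : Fin n → Fin n → Fin n
  conj g h = g ⁻¹ ∙ (h ∙ g)

  ∙-conj : ∀ g h → h ∙ g ≡ g ∙ conj g h
  ∙-conj g h = sym (cancel-∙⁻¹ g (h ∙ g))

  -- Closure under products is a field because solution sets need not be subgroups. Normality refers
  -- to the whole group, so that it still covers the larger set of roots at the next level; the
  -- centralizer is taken among the roots only.
  record SelfCentralizing (d : ℕ) : Set where
    field
      root-∙      : ∀ {x y} → Root d x → Root d y → Root d (x ∙ y)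
      c           : Fin n
      root-c      : Root d c
      normal      : ∀ g → Normalizes g ⟨ c ⟩
      centralizer : ∀ {y} → Root d y → Commute y c → ⟨ c ⟩ y

    root-sub : Sub (Root d)
    root-sub = record { mem? = λ x → x ↑ d ≟ᶠ ε ; ε∈ = ε↑ d ; ∙∈ = root-∙ }

  roots≡order : ∀ {d} (S : SelfCentralizing d) → roots whole-sub d ≡ Sub.order (SelfCentralizing.root-sub S)
  roots≡order S = count-cong _ (Sub.mem? (SelfCentralizing.root-sub S)) proj₂ (_ ,_)

  commute-⟨⟩ : ∀ {x y z} → Commute y x → ⟨ x ⟩ z → Commute y z
  commute-⟨⟩ {x} {y} yx z∈ with ⟨⟩-elim z∈
  ... | k , _ , refl = commute-↑ʳ k yx

  self-centralizing-1 : SelfCentralizing 1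
  self-centralizing-1 = record
    { root-∙ = λ {x} {y} x1 y1 → trans (↑-1 _) (trans (cong₂ _∙_ (trans (sym (↑-1 x)) x1) (trans (sym (↑-1 y)) y1)) (identityˡ ε))
    ; c = ε
    ; root-c = ↑-1 ε
    ; normal = λ g {h} h∈ → h , h∈ , sym (commute-⟨⟩ {ε} {g} (sym commute-ε) h∈)
    ; centralizer = λ {y} y1 _ → subst ⟨ ε ⟩ (trans (sym y1) (↑-1 y)) (Sub.ε∈ (⟨⟩-sub ε)) }

  module Ascent {d p} (pp : Prime p) {b m} (d≡ : d ≡ p ^ suc b * m) (p∤m : ¬ p ∣ m) (0<m : 0 < m)
    (root-count : RootCount d) (root-count′ : RootCount (p ^ b * m)) (S : SelfCentralizing (p ^ b * m)) where

    private module S = SelfCentralizing S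
    open S using () renaming (c to c′)

    d′ : ℕ
    d′ = p ^ b * m

    d≡pd′ : d ≡ p * d′
    d≡pd′ = trans d≡ (*-assoc p (p ^ b) m)

    Root′⊆Root : ∀ {x} → Root d′ x → Root d x
    Root′⊆Root e = ↑-∣ e (subst (d′ ∣_) (sym d≡pd′) (n∣m*n p))

    module Outside = CoprimeParts (prime^-∤⇒coprime (suc b) pp p∤m) (prime^>0 pp (suc b)) 0<m
    module Inside = CoprimeParts (prime^-∤⇒coprime b pp p∤m) (prime^>0 pp b) 0<m

    PRoot : Fin n → Set
    PRoot x = x ↑ (p ^ suc b) ≡ ε × ¬ Root d′ x

    -- The other part of `y` has period `m` and so is a root for `d′` in any case; if the `p`-part
    -- were one too, so would be `y`.
    p-part-outside : ∀ {y} → Root d y → ¬ Root d′ y → PRoot (Outside.k-part y)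
    p-part-outside {y} yd ¬yd′ = Outside.k-part-period yd″ , λ kd′ → ¬yd′ (subst (Root d′) (sym (Outside.∙-parts y))
      (S.root-∙ (↑-∣ (Outside.l-part-period yd″) (n∣m*n (p ^ b))) kd′))
      where
      yd″ : y ↑ (p ^ suc b * m) ≡ ε
      yd″ = trans (cong (y ↑_) (sym d≡)) yd

    root-∈-normal : ∀ g → Normalizes g (Root d′)
    root-∈-normal g {h} hd = conj g h , root-conj (∙-conj g h) hd , ∙-conj g h

    ↑p∈ : ∀ {x} → PRoot x → Root d′ (x ↑ p)
    ↑p∈ {x} (xp , _) = trans (sym (↑-*′ x p d′)) (↑-∣ xp (subst (p ^ suc b ∣_) (*-assoc p (p ^ b) m) (m∣m*n m)))

    -- Adjoining `x` to the roots for `d′` yields a subgroup of order `d`. By Lagrange its elements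
    -- are roots for `d`, of which there are just `d`, so it consists of all of them.
    module Over {x} (px : PRoot x) where
      open Extension S.root-sub x (root-∈-normal x) public

      over-order : Sub.order ext-sub ≡ d
      over-order = trans ext-order (trans
        (cong₂ _*_ (prime-index S.root-sub (root-∈-normal x) pp (↑p∈ px) (proj₂ px)) (trans (sym (roots≡order S)) root-count′))
        (sym d≡pd′))

      ext⊆root : ∀ {y} → Ext y → Root d y
      ext⊆root {y} y∈ = subst (λ k → y ↑ k ≡ ε) over-order (↑-order ext-sub y∈)

      root⊆ext : ∀ {y} → Root d y → Ext y
      root⊆ext {y} = count-≥⇒⊇ (Sub.mem? ext-sub) (λ y → y ↑ d ≟ᶠ ε) ext⊆root
        (≤-reflexive (trans (count-cong _ _ (_ ,_) proj₂) (trans root-count (sym over-order))))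

    outside : ∃[ y ] (Root d y × ¬ Root d′ y)
    outside = count-<⇒∃ (Sub.mem? S.root-sub) (λ y → y ↑ d ≟ᶠ ε)
      (subst₂ _<_ (trans (sym root-count′) (roots≡order S)) (trans (sym root-count) (count-cong _ _ proj₂ (_ ,_)))
        (subst (d′ <_) (trans (*-comm d′ p) (sym d≡pd′))
          (m<m*n d′ p {{>-nonZero (*-mono-≤ (prime^>0 pp b) 0<m)}} (prime>1 pp))))

    root-∙ : ∀ {x y} → Root d x → Root d y → Root d (x ∙ y)
    root-∙ xd yd = ext⊆root (Sub.∙∈ ext-sub (root⊆ext xd) (root⊆ext yd))
      where open Over (p-part-outside (proj₁ (proj₂ outside)) (proj₂ (proj₂ outside)))

    root-sub : Sub (Root d)
    root-sub = record { mem? = λ x → x ↑ d ≟ᶠ ε ; ε∈ = ε↑ d ; ∙∈ = root-∙ }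

    C : Fin n → Set
    C = Centralizer (Root d) c′

    C-sub : Sub C
    C-sub = centralizer-sub root-sub c′

    c′∈C : C c′
    c′∈C = Root′⊆Root S.root-c , refl

    -- Conjugation by `g` takes `c′` to some `c₂` in `⟨ c′ ⟩`. What commutes with `c′` also commutes
    -- with `c₂`, and conjugating back gives the claim.
    C-normal : ∀ {g h h′} → h ∙ g ≡ g ∙ h′ → C h → C h′
    C-normal {g} {h} {h′} eqn (hd , hc) = root-conj eqn hd , ∙-cancelˡ g _ _ (begin
      g ∙ (h′ ∙ c′)    ≡⟨ assoc g h′ c′ ⟨
      g ∙ h′ ∙ c′      ≡⟨ cong (_∙ c′) eqn ⟨
      h ∙ g ∙ c′       ≡⟨ assoc h g c′ ⟩
      h ∙ (g ∙ c′)     ≡⟨ cong (h ∙_) gc′ ⟩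
      h ∙ (c₂ ∙ g)     ≡⟨ assoc h c₂ g ⟨
      h ∙ c₂ ∙ g       ≡⟨ cong (_∙ g) (commute-⟨⟩ hc c₂∈) ⟩
      c₂ ∙ h ∙ g       ≡⟨ assoc c₂ h g ⟩
      c₂ ∙ (h ∙ g)     ≡⟨ cong (c₂ ∙_) eqn ⟩
      c₂ ∙ (g ∙ h′)    ≡⟨ assoc c₂ g h′ ⟨
      c₂ ∙ g ∙ h′      ≡⟨ cong (_∙ h′) gc′ ⟨
      g ∙ c′ ∙ h′      ≡⟨ assoc g c′ h′ ⟩
      g ∙ (c′ ∙ h′)    ∎)
      where
      open ≡-Reasoning
      c₂ : Fin n
      c₂ = proj₁ (S.normal (g ⁻¹) (x∈⟨x⟩ c′))
      c₂∈ : ⟨ c′ ⟩ c₂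
      c₂∈ = proj₁ (proj₂ (S.normal (g ⁻¹) (x∈⟨x⟩ c′)))
      gc′ : g ∙ c′ ≡ c₂ ∙ g
      gc′ = ∙-cancelʳ (g ⁻¹) _ _ (begin
        g ∙ c′ ∙ g ⁻¹        ≡⟨ assoc g c′ _ ⟩
        g ∙ (c′ ∙ g ⁻¹)      ≡⟨ cong (g ∙_) (proj₂ (proj₂ (S.normal (g ⁻¹) (x∈⟨x⟩ c′)))) ⟩
        g ∙ (g ⁻¹ ∙ c₂)      ≡⟨ cancel-∙⁻¹ g c₂ ⟩
        c₂                   ≡⟨ identityʳ c₂ ⟨
        c₂ ∙ ε               ≡⟨ cong (c₂ ∙_) (inverseʳ g) ⟨
        c₂ ∙ (g ∙ g ⁻¹)      ≡⟨ assoc c₂ g _ ⟨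
        c₂ ∙ g ∙ g ⁻¹        ∎)

    -- Replacing the p-part of c′ by x.
    module Enlarge {x} (px : PRoot x) (Cx : C x) where

      w : Fin n
      w = Inside.l-part c′

      s : Fin n
      s = Inside.k-part c′

      xw : Commute x w
      xw = commute-⟨⟩ (proj₂ Cx) (Inside.l-part∈ (⟨⟩-sub c′) (x∈⟨x⟩ c′))

      wm : w ↑ m ≡ ε
      wm = Inside.l-part-period S.root-c

      c : Fin n
      c = x ∙ w

      Cc : C c
      Cc = Sub.∙∈ C-sub Cx (Inside.l-part∈ C-sub c′∈C)

      open ExactOrder pp b using (exact-ord)

      ord-x : ord x ≡ p ^ suc b
      ord-x = exact-ord (proj₁ px , λ xb → proj₂ px (↑-∣ xb (m∣m*n m)))

      -- `x ↑ k` is inverse to `w ↑ k`, so it has the coprime periods `p ^ suc b` and `m`.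
      x-period : ∀ {k} → c ↑ k ≡ ε → x ↑ k ≡ ε
      x-period {k} ck = coprime-periods (prime^-∤⇒coprime (suc b) pp p∤m)
        (trans (sym (↑-*′ x k _)) (↑-∣ (proj₁ px) (n∣m*n k)))
        (begin
          (x ↑ k) ↑ m               ≡⟨ identityʳ _ ⟨
          (x ↑ k) ↑ m ∙ ε           ≡⟨ cong ((x ↑ k) ↑ m ∙_) (trans (sym (↑-*′ w k m)) (↑-∣ wm (n∣m*n k))) ⟨
          (x ↑ k) ↑ m ∙ (w ↑ k) ↑ m ≡⟨ ∙-↑ m (commute-↑ˡ k (commute-↑ʳ k xw)) ⟨
          (x ↑ k ∙ w ↑ k) ↑ m       ≡⟨ cong (_↑ m) (∙-↑ k xw) ⟨
          (c ↑ k) ↑ m               ≡⟨ cong (_↑ m) ck ⟩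
          ε ↑ m                     ≡⟨ ε↑ m ⟩
          ε                         ∎)
        where open ≡-Reasoning

      w-period : ∀ {k} → c ↑ k ≡ ε → w ↑ k ≡ ε
      w-period {k} ck = begin
        w ↑ k           ≡⟨ identityˡ _ ⟨
        ε ∙ w ↑ k       ≡⟨ cong (_∙ w ↑ k) (x-period ck) ⟨
        x ↑ k ∙ w ↑ k   ≡⟨ ∙-↑ k xw ⟨
        c ↑ k           ≡⟨ ck ⟩
        ε               ∎
        where open ≡-Reasoning

      -- `ord c` is `p * k′` for a multiple `k′` of `p ^ b`. Both parts of `c′` have period `k′`:
      -- `s` since `p ^ b` divides `k′`, and `w` since the factor `p` is prime to its period `m`.
      ord-c-∣ : p * ord c′ ∣ ord c
      ord-c-∣ with subst (_∣ ord c) ord-x (ord-∣ x (x-period (↑ord c)))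
      ... | divides j k≡ = subst (p * ord c′ ∣_) (sym k≡′) (*-monoʳ-∣ p (ord-∣ c′ (begin
        c′ ↑ k′          ≡⟨ cong (_↑ k′) (Inside.∙-parts c′) ⟩
        (w ∙ s) ↑ k′     ≡⟨ ∙-↑ k′ (sym (Inside.k-part-commute c′)) ⟩
        w ↑ k′ ∙ s ↑ k′  ≡⟨ cong₂ _∙_ wk′ (↑-∣ (Inside.k-part-period S.root-c) (n∣m*n j)) ⟩
        ε ∙ ε            ≡⟨ identityˡ ε ⟩
        ε                ∎)))
        where
        open ≡-Reasoning
        k′ : ℕ
        k′ = j * p ^ b
        k≡′ : ord c ≡ p * k′
        k≡′ = begin
          ord c             ≡⟨ k≡ ⟩
          j * (p * p ^ b)   ≡⟨ *-assoc j p _ ⟨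
          j * p * p ^ b     ≡⟨ cong (_* p ^ b) (*-comm j p) ⟩
          p * j * p ^ b     ≡⟨ *-assoc p j _ ⟩
          p * k′            ∎
        wk′ : w ↑ k′ ≡ ε
        wk′ = coprime-periods (prime-∤⇒coprime pp p∤m)
          (trans (sym (↑-* w p k′)) (trans (cong (w ↑_) (sym k≡′)) (w-period (↑ord c))))
          (trans (sym (↑-*′ w k′ m)) (↑-∣ wm (n∣m*n k′)))

      ⟨c′⟩⊆Root′ : ∀ {y} → ⟨ c′ ⟩ y → Root d′ y
      ⟨c′⟩⊆Root′ = ⟨⟩-⊆ S.root-sub S.root-c

      normalizes : Normalizes x ⟨ c′ ⟩
      normalizes {h} h∈ = h , h∈ , sym (commute-⟨⟩ (proj₂ Cx) h∈)

      module A = Extension (⟨⟩-sub c′) x normalizes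

      A-order : Sub.order A.ext-sub ≡ p * ord c′
      A-order = trans A.ext-order (cong₂ _*_
        (prime-index (⟨⟩-sub c′) normalizes pp (S.centralizer (↑p∈ px) (commute-↑ˡ p (proj₂ Cx))) (proj₂ px ∘ ⟨c′⟩⊆Root′))
        (⟨⟩-order c′))

      C⊆A : ∀ {y} → C y → A.Ext y
      C⊆A {y} Cy@(yd , _) with Over.root⊆ext px yd
      ... | i , h , hd′ , y≡ = subst A.Ext (sym y≡) (A.ext-intro (toℕ i)
        (S.centralizer hd′ (proj₂ (Sub.cancelˡ C-sub (Sub.↑∈ C-sub (toℕ i) Cx) (subst C y≡ Cy)))))

      -- `C` lies between `⟨ c ⟩` and the extension of `⟨ c′ ⟩` by `x`, whose order `p * ord c′` is
      -- at most `ord c`. So all three coincide.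
      C⊆⟨c⟩ : ∀ {y} → C y → ⟨ c ⟩ y
      C⊆⟨c⟩ = count-≥⇒⊇ (Sub.mem? (⟨⟩-sub c)) (Sub.mem? C-sub) (⟨⟩-⊆ C-sub Cc)
        (≤-trans (count-mono (Sub.mem? C-sub) (Sub.mem? A.ext-sub) C⊆A)
          (≤-trans (≤-reflexive A-order)
            (≤-trans (∣⇒≤ {{>-nonZero (ord>0 c)}} ord-c-∣) (≤-reflexive (sym (⟨⟩-order c))))))

      enlarged : SelfCentralizing d
      enlarged = record
        { root-∙ = root-∙
        ; c = c
        ; root-c = proj₁ Cc
        ; normal = λ g {h} h∈ → conj g h ,
            C⊆⟨c⟩ (C-normal (∙-conj g h) (⟨⟩-⊆ C-sub Cc h∈)) , ∙-conj g h
        ; centralizer = λ yd yc → C⊆⟨c⟩ (yd , commute-⟨⟩ yc (C⊆⟨c⟩ c′∈C)) }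

    ascent : SelfCentralizing d
    ascent with any? (λ y → Sub.mem? C-sub y ×-dec ¬? (Sub.mem? (⟨⟩-sub c′) y))
    -- If `y` were a root for `d′`, it would lie in `⟨ c′ ⟩`. So its `p`-part is outside the roots
    -- for `d′` and, being a power of `y` up to inverses, still in `C`.
    ... | yes (y , Cy@(yd , yc) , y∉) =
      Enlarge.enlarged (p-part-outside yd λ yd′ → y∉ (S.centralizer yd′ yc)) (Outside.k-part∈ C-sub Cy)
    ... | no ¬∃ = record
      { root-∙ = root-∙ ; c = c′ ; root-c = proj₁ c′∈C ; normal = S.normal
      ; centralizer = λ {y} yd yc → decide y (yd , yc) (Sub.mem? (⟨⟩-sub c′) y) }
      where
      decide : ∀ y → C y → Dec (⟨ c′ ⟩ y) → ⟨ c′ ⟩ y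
      decide y Cy (yes y∈) = y∈
      decide y Cy (no y∉)  = contradiction (y , Cy , y∉) ¬∃

  self-centralizing : IsZGroup G → ∀ d r → RootCount d → UpperPart d r → SelfCentralizing d
  self-centralizing Z = <-rec _ go
    where
    go : ∀ d → (∀ {d′} → d′ < d → ∀ r → RootCount d′ → UpperPart d′ r → SelfCentralizing d′) →
         ∀ r → RootCount d → UpperPart d r → SelfCentralizing d
    go zero rec r root-count (n≡ , _) = contradiction n≡ (>⇒≢ 0<n)
    go (suc zero) rec r root-count upper = self-centralizing-1
    go d@(suc (suc _)) rec r root-count upper with least-prime-factor {d} (s≤s z<s)
    ... | p , pp , p∣d , p-least with prime-part pp d z<s
    ...   | zero , m , d≡ , p∤m = contradiction (subst (p ∣_) (trans d≡ (*-identityˡ m)) p∣d) p∤m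
    ...   | suc b , m , d≡ , p∤m = Ascent.ascent pp {b} {m} d≡ p∤m 0<m root-count root-count′ (rec d′<d (p * r) root-count′ upper′)
      where open Descent Z root-count upper pp p-least {b} {m} d≡ p∤m

  self-centralizing-n : IsZGroup G → SelfCentralizing n
  self-centralizing-n Z = self-centralizing Z n 1
    (trans (count-cong _ (Sub.mem? whole-sub) _ (λ {x} _ → _ , ↑n x)) whole-order)
    (sym (*-identityʳ n) , λ pp _ p∣1 _ → contradiction (∣1⇒≡1 p∣1) (>⇒≢ (prime>1 pp)))

  -- Coordinates relative to the cyclic subgroup

  -- The class of c lies in ⟨ c ⟩, and its stabilizer is ⟨ c ⟩.
  module LargeCyclic (S : SelfCentralizing n) where
    open SelfCentralizing S
    open Conjugacy whole-sub (Sub.mem? whole-sub) _ using (_~?_; class-order)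

    index : ℕ
    index = count (c ~?_)

    index*ord : index * ord c ≡ n
    index*ord = trans (cong (index *_) (trans (sym (⟨⟩-order c))
        (count-cong (Sub.mem? (⟨⟩-sub c)) (Sub.mem? (centralizer-sub whole-sub c))
          (λ y∈ → _ , sym (commute-⟨⟩ refl y∈)) (λ {y} (_ , yc) → centralizer (↑n y) yc))))
      (trans (class-order {c} _) whole-order)

    class⊆ : ∀ {h y} → h ∙ c ≡ y ∙ h → ⟨ c ⟩ y
    class⊆ {h} {y} hc≡yh =
      let y′ , y′∈ , eqn = normal (h ⁻¹) (x∈⟨x⟩ c) in
      subst ⟨ c ⟩ (∙-cancelʳ h _ _ (begin
        y′ ∙ h                ≡⟨ cancel-∙⁻¹ h _ ⟨
        h ∙ (h ⁻¹ ∙ (y′ ∙ h)) ≡⟨ cong (h ∙_) (assoc _ y′ h) ⟨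
        h ∙ (h ⁻¹ ∙ y′ ∙ h)   ≡⟨ cong (λ z → h ∙ (z ∙ h)) eqn ⟨
        h ∙ (c ∙ h ⁻¹ ∙ h)    ≡⟨ cong (h ∙_) (trans (assoc c _ h) (trans (cong (c ∙_) (inverseˡ h)) (identityʳ c))) ⟩
        h ∙ c                 ≡⟨ hc≡yh ⟩
        y ∙ h                 ∎)) y′∈
      where open ≡-Reasoning

    index≤ord : index ≤ ord c
    index≤ord = ≤-trans
      (count-mono (c ~?_) (Sub.mem? (⟨⟩-sub c)) λ (_ , h , _ , hc≡yh) → class⊆ hc≡yh)
      (≤-reflexive (⟨⟩-order c))

  -- t enumerates representatives of the left cosets of ⟨ c ⟩.
  record Coordinates : Set where
    field
      m k         : ℕ
      k*m≡n       : k * m ≡ n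
      k≤m         : k ≤ m
      c           : Fin n
      c-period    : c ↑ m ≡ ε
      t           : ℕ → Fin n
      i u         : Fin n → ℕ
      i<k         : ∀ x → i x < k
      u<m         : ∀ x → u x < m
      coordinates : ∀ x → x ≡ t (i x) ∙ c ↑ u x

    0<m : 0 < m
    0<m = ∣⇒>0 (subst (m ∣_) k*m≡n (n∣m*n k)) 0<n

    0<k : 0 < k
    0<k = ∣⇒>0 (subst (k ∣_) k*m≡n (m∣m*n m)) 0<n

    instance
      m≢0 : NonZero m
      m≢0 = >-nonZero 0<m
      k≢0 : NonZero k
      k≢0 = >-nonZero 0<k

    c-% : ∀ a → c ↑ (a % m) ≡ c ↑ a
    c-% a = sym (begin
      c ↑ a                              ≡⟨ cong (c ↑_) (m≡m%n+[m/n]*n a m) ⟩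
      c ↑ (a % m + a / m * m)            ≡⟨ ↑-+ c (a % m) _ ⟩
      c ↑ (a % m) ∙ c ↑ (a / m * m)      ≡⟨ cong (c ↑ (a % m) ∙_) (↑-∣ c-period (n∣m*n (a / m))) ⟩
      c ↑ (a % m) ∙ ε                    ≡⟨ identityʳ _ ⟩
      c ↑ (a % m)                        ∎)
      where open ≡-Reasoning

    -- Moving a power of c past a coset representative.
    slide : Fin n → Fin n → Fin n
    slide x y = c ↑ u x ∙ t (i y)

    top : Fin n → Fin n → Fin n
    top x y = t (i x) ∙ t (i (slide x y))

    exponent-sum : Fin n → Fin n → ℕ
    exponent-sum x y = u y + u (slide x y) + u (top x y)

    -- Replacing `slide x y` and `top x y` by their own coordinates moves all powers of `c` to the
    -- right, where the exponents add modulo `m`.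
    ∙-coordinates : ∀ x y → t (i (top x y)) ∙ c ↑ (exponent-sum x y % m) ≡ x ∙ y
    ∙-coordinates x y = begin
      t (i z′) ∙ c ↑ ((u y + u z + u z′) % m)       ≡⟨ cong (t (i z′) ∙_) (c-% (u y + u z + u z′)) ⟩
      t (i z′) ∙ c ↑ (u y + u z + u z′)             ≡⟨ cong (λ a → t (i z′) ∙ c ↑ a)
                                                         (trans (+-comm _ (u z′)) (cong (u z′ +_) (+-comm (u y) (u z)))) ⟩
      t (i z′) ∙ c ↑ (u z′ + (u z + u y))           ≡⟨ cong (t (i z′) ∙_) (↑-+ c (u z′) _) ⟩
      t (i z′) ∙ (c ↑ u z′ ∙ c ↑ (u z + u y))       ≡⟨ assoc _ _ _ ⟨
      t (i z′) ∙ c ↑ u z′ ∙ c ↑ (u z + u y)         ≡⟨ cong (_∙ c ↑ (u z + u y)) (coordinates z′) ⟨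
      t (i x) ∙ t (i z) ∙ c ↑ (u z + u y)           ≡⟨ cong (t (i x) ∙ t (i z) ∙_) (↑-+ c (u z) (u y)) ⟩
      t (i x) ∙ t (i z) ∙ (c ↑ u z ∙ c ↑ u y)       ≡⟨ assoc _ _ _ ⟩
      t (i x) ∙ (t (i z) ∙ (c ↑ u z ∙ c ↑ u y))     ≡⟨ cong (t (i x) ∙_) (assoc _ _ _) ⟨
      t (i x) ∙ (t (i z) ∙ c ↑ u z ∙ c ↑ u y)       ≡⟨ cong (λ w → t (i x) ∙ (w ∙ c ↑ u y)) (coordinates z) ⟨
      t (i x) ∙ (c ↑ u x ∙ t (i y) ∙ c ↑ u y)       ≡⟨ cong (t (i x) ∙_) (assoc _ _ _) ⟩
      t (i x) ∙ (c ↑ u x ∙ (t (i y) ∙ c ↑ u y))     ≡⟨ cong (λ w → t (i x) ∙ (c ↑ u x ∙ w)) (coordinates y) ⟨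
      t (i x) ∙ (c ↑ u x ∙ y)                       ≡⟨ assoc _ _ y ⟨
      t (i x) ∙ c ↑ u x ∙ y                         ≡⟨ cong (_∙ y) (coordinates x) ⟨
      x ∙ y                                         ∎
      where
      open ≡-Reasoning
      z z′ : Fin n
      z  = slide x y
      z′ = top x y

  module _ (S : SelfCentralizing n) where
    open SelfCentralizing S using (c)
    open LargeCyclic S
    private
      A = ⟨⟩-sub c
      _~?_ : ∀ x y → Dec (Coset ⟨ c ⟩ x y)
      _~?_ = coset? A
      X? : ∀ (x : Fin n) → Dec ⊤
      X? _ = yes _

    open Partition X? _~?_ _ (λ _ → coset-refl A) (coset-sym A) (coset-trans A)
    open Enumerate Rep? ε

    private
      representative : ∀ x → ∃[ r ] (Rep r × Coset ⟨ c ⟩ r x)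
      representative x = rep _

      exponent : ∀ x → ∃[ j ] (j < ord c × x ≡ proj₁ (representative x) ∙ c ↑ j)
      exponent x =
        let r , _ , h , h∈ , x≡ = representative x
            j , j< , h≡ = ⟨⟩-elim h∈
        in j , j< , trans x≡ (cong (r ∙_) h≡)

    rep-count : count Rep? * ord c ≡ n
    rep-count = begin
      count Rep? * ord c
        ≡⟨ double-count Rep? X? (λ r x → Rep? r ×-dec (r ~? x)) (λ (Rr , _) → Rr , _)
             (λ {r} Rr → trans (trans (count-cong (λ x → Rep? r ×-dec (r ~? x)) (r ~?_) proj₂ (Rr ,_)) (coset-count A r)) (⟨⟩-order c))
             (λ {x} _ → let r , Rr , r~x = representative x in
               count-unique (λ r → Rep? r ×-dec (r ~? x)) (Rr , r~x) λ (Rs , s~x) → rep-unique Rs s~x Rr r~x) ⟩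
      count X? * 1
        ≡⟨ *-identityʳ _ ⟩
      count X?
        ≡⟨ count-all X? _ ⟩
      n ∎
      where
      open ≡-Reasoning

    rep-count≡index : count Rep? ≡ index
    rep-count≡index = *-cancelʳ-≡ _ _ (ord c) {{>-nonZero (ord>0 c)}} (trans rep-count (sym index*ord))

    coset-coordinates : Coordinates
    coset-coordinates = record
      { m = ord c
      ; k = index
      ; k*m≡n = index*ord
      ; k≤m = index≤ord
      ; c = c
      ; c-period = ↑ord c
      ; t = element
      ; i = λ x → rank (proj₁ (representative x))
      ; u = λ x → proj₁ (exponent x)
      ; i<k = λ x → subst (rank (proj₁ (representative x)) <_) rep-count≡index
          (rank<count (proj₁ (proj₂ (representative x))))
      ; u<m = λ x → proj₁ (proj₂ (exponent x))
      ; coordinates = λ x → trans (proj₂ (proj₂ (exponent x)))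
          (cong (_∙ c ↑ proj₁ (exponent x)) (sym (element-rank (proj₁ (proj₂ (representative x))))))
      }

  opaque
    group-coordinates : IsZGroup G → Coordinates
    group-coordinates Z = coset-coordinates (self-centralizing-n Z)

-- The multiplication program and its execution

-- For operands x and y with blocks at 8x and 8y, registers 3 and 0 come to hold
-- the block addresses of z = c ↑ u x ∙ t (i y) and z′ = t (i x) ∙ t (i z).
multiply : Program 7
multiply =
  const 2F 8 ∷
  op mul 0F 0F 2F ∷
  op mul 1F 1F 2F ∷
  const 4F 1 ∷
  op add 3F 0F 4F ∷
  load 3F 3F ∷
  const 5F 2 ∷
  op add 6F 1F 5F ∷
  load 6F 6F ∷
  op add 3F 3F 6F ∷
  load 3F 3F ∷
  load 0F 0F ∷
  op add 6F 3F 5F ∷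
  load 6F 6F ∷
  op add 0F 0F 6F ∷
  load 0F 0F ∷
  const 4F 6 ∷
  op add 1F 1F 4F ∷
  load 1F 1F ∷
  op add 3F 3F 4F ∷
  load 3F 3F ∷
  op add 1F 1F 3F ∷
  op add 3F 0F 4F ∷
  load 3F 3F ∷
  op add 1F 1F 3F ∷
  const 3F 0 ∷
  load 3F 3F ∷
  op rem 1F 1F 3F ∷
  op mul 1F 1F 2F ∷
  const 3F 7 ∷
  op add 0F 0F 3F ∷
  load 0F 0F ∷
  op add 0F 0F 1F ∷
  load 0F 0F ∷
  halt ∷ []

-- The memory holds the first `s` values of `mem`. Numbers below `s` fit into a word, so `s` bounds
-- addresses and operands alike.
module Execution (w s : ℕ) (s≤2^w : s ≤ 2 ^ w) (mem : ℕ → ℕ) where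
  open Machine w

  M : Vec Word s
  M = tabulate λ i → word (mem (toℕ i))

  toℕ-word : ∀ {a} → a < s → toℕ (word a) ≡ a
  toℕ-word a<s = trans (toℕ-fromℕ< _) (m<n⇒m%n≡m (<-≤-trans a<s s≤2^w))

  NotHalt : ∀ {r} → Instruction r → Set
  NotHalt halt = ⊥
  NotHalt _    = ⊤

  step : ∀ {r t} {P : Program r} {S S′ : State r s} {i} → NotHalt i →
         fetch P (State.pc S) ≡ just i → exec i S ≡ just S′ → run (suc t) P S ≡ run t P S′
  step {t = t} {P} {i = const _ _} _ f e rewrite f = cong (_>>= run t P) e
  step {t = t} {P} {i = copy _ _} _ f e rewrite f = cong (_>>= run t P) e
  step {t = t} {P} {i = op _ _ _ _} _ f e rewrite f = cong (_>>= run t P) e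
  step {t = t} {P} {i = load _ _} _ f e rewrite f = cong (_>>= run t P) e
  step {t = t} {P} {i = store _ _} _ f e rewrite f = cong (_>>= run t P) e
  step {t = t} {P} {i = jump _} _ f e rewrite f = cong (_>>= run t P) e
  step {t = t} {P} {i = jumpz _ _} _ f e rewrite f = cong (_>>= run t P) e

  -- A record, so that its indices can be inferred.
  record Runs {r} (t : ℕ) (P : Program r) (pc : ℕ) (R : Vec Word r) (X : Maybe (State r s)) : Set where
    constructor runs
    field result≡ : run t P (state pc R M) ≡ X

  open Runs

  module _ {r t : ℕ} {P : Program r} {pc : ℕ} {R : Vec Word r} {X : Maybe (State r s)} where

    run-const : ∀ {d v} → fetch P pc ≡ just (const d v) →
                Runs t P (suc pc) (R [ d ]≔ word v) X →
                Runs (suc t) P pc R X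
    run-const f h = runs (trans (step {t = t} {P} _ f refl) (result≡ h))

    run-add : ∀ {d a b α β} → fetch P pc ≡ just (op add d a b) →
              lookup R a ≡ word α → lookup R b ≡ word β → α < s → β < s →
              Runs t P (suc pc) (R [ d ]≔ word (α + β)) X →
              Runs (suc t) P pc R X
    run-add {d} {a} {b} {α} {β} f e₁ e₂ α< β< h = runs (trans (step {t = t} {P} _ f exec≡) (result≡ h))
      where
      exec≡ : exec (op add d a b) (state pc R M) ≡ just (state (suc pc) (R [ d ]≔ word (α + β)) M)
      exec≡ rewrite e₁ | e₂ | toℕ-word α< | toℕ-word β< = refl

    run-mul : ∀ {d a b α β} → fetch P pc ≡ just (op mul d a b) →
              lookup R a ≡ word α → lookup R b ≡ word β → α < s → β < s →
              Runs t P (suc pc) (R [ d ]≔ word (α * β)) X →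
              Runs (suc t) P pc R X
    run-mul {d} {a} {b} {α} {β} f e₁ e₂ α< β< h = runs (trans (step {t = t} {P} _ f exec≡) (result≡ h))
      where
      exec≡ : exec (op mul d a b) (state pc R M) ≡ just (state (suc pc) (R [ d ]≔ word (α * β)) M)
      exec≡ rewrite e₁ | e₂ | toℕ-word α< | toℕ-word β< = refl

    run-rem : ∀ {d a b α β} .{{_ : NonZero β}} → fetch P pc ≡ just (op rem d a b) →
              lookup R a ≡ word α → lookup R b ≡ word β → α < s → β < s →
              Runs t P (suc pc) (R [ d ]≔ word (α % β)) X →
              Runs (suc t) P pc R X
    run-rem {d} {a} {b} {α} {suc β} f e₁ e₂ α< β< h = runs (trans (step {t = t} {P} _ f exec≡) (result≡ h))
      where
      exec≡ : exec (op rem d a b) (state pc R M) ≡ just (state (suc pc) (R [ d ]≔ word (α % suc β)) M)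
      exec≡ rewrite e₁ | e₂ | toℕ-word α< | toℕ-word β< = refl

    run-load : ∀ {d a α} → fetch P pc ≡ just (load d a) → lookup R a ≡ word α → α < s →
               Runs t P (suc pc) (R [ d ]≔ word (mem α)) X →
               Runs (suc t) P pc R X
    run-load {d} {a} {α} f e α< h = runs (trans (step {t = t} {P} _ f exec≡) (result≡ h))
      where
      exec≡ : exec (load d a) (state pc R M) ≡ just (state (suc pc) (R [ d ]≔ word (mem α)) M)
      exec≡ rewrite e with toℕ (word α) <? s
      ... | no ≮s = contradiction (subst (_< s) (sym (toℕ-word α<)) α<) ≮s
      ... | yes <s = cong (λ v → just (state (suc pc) (R [ d ]≔ v) M))
        (trans (lookup∘tabulate _ (fromℕ< <s)) (cong (word ∘ mem) (trans (toℕ-fromℕ< <s) (toℕ-word α<))))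

  module _ (x y : ℕ) where

    z z′ total : ℕ
    z      = mem (mem (x * 8 + 1) + mem (y * 8 + 2))
    z′     = mem (mem (x * 8) + mem (z + 2))
    total  = mem (y * 8 + 6) + mem (z + 6) + mem (z′ + 6)

    module _ .{{m≢0 : NonZero (mem 0)}} where

      index : ℕ
      index = mem (z′ + 7) + total % mem 0 * 8

      -- The hypotheses keep all addresses and operands below `s`: no access faults, and the words
      -- stand for the intended numbers. The time is 34 instructions and one unit for `halt`.
      run-multiply : 8 < s → x * 8 + 1 < s → y * 8 + 6 < s → mem (x * 8 + 1) + mem (y * 8 + 2) < s →
        z + 6 < s → mem (x * 8) + mem (z + 2) < s → z′ + 7 < s → total < s → mem 0 < s → index < s →
        ∃[ R ] (run 35 multiply (state 0 (word x ∷ word y ∷ replicate 5 (word 0)) M)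
          ≡ just (state 34 (word (mem index) ∷ R) M))
      run-multiply 8< x< y< a< z< b< z′< total< m< index< = _ ,
        result≡ {t = 35} {multiply} {0} {word x ∷ word y ∷ replicate 5 (word 0)} (run-const refl
        (run-mul refl refl refl (≤-<-trans (m≤m*n x 8) x8<) 8<
        (run-mul refl refl refl (≤-<-trans (m≤m*n y 8) y8<) 8<
        (run-const refl
        (run-add refl refl refl x8< (small 1)
        (run-load refl refl x<
        (run-const refl
        (run-add refl refl refl y8< (small 2)
        (run-load refl refl (offset y< (≤ᵇ⇒≤ 2 _ _))
        (run-add refl refl refl (≤-<-trans (m≤m+n _ _) a<) (≤-<-trans (m≤n+m _ (mem (x * 8 + 1))) a<)
        (run-load refl refl a<
        (run-load refl refl x8<
        (run-add refl refl refl z₀< (small 2)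
        (run-load refl refl (offset z< (≤ᵇ⇒≤ 2 _ _))
        (run-add refl refl refl (≤-<-trans (m≤m+n _ _) b<) (≤-<-trans (m≤n+m _ (mem (x * 8))) b<)
        (run-load refl refl b<
        (run-const refl
        (run-add refl refl refl y8< (small 6)
        (run-load refl refl y<
        (run-add refl refl refl z₀< (small 6)
        (run-load refl refl z<
        (run-add refl refl refl (≤-<-trans (m≤m+n _ _) yz<) (≤-<-trans (m≤n+m _ (mem (y * 8 + 6))) yz<)
        (run-add refl refl refl z₀′< (small 6)
        (run-load refl refl (offset z′< (≤ᵇ⇒≤ 6 _ _))
        (run-add refl refl refl yz< (≤-<-trans (m≤n+m _ (mem (y * 8 + 6) + mem (z + 6))) total<)
        (run-const refl
        (run-load refl refl (≤-<-trans z≤n 8<)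
        (run-rem refl refl refl total< m<
        (run-mul refl refl refl (≤-<-trans (m%n≤m total (mem 0)) total<) 8<
        (run-const refl
        (run-add refl refl refl z₀′< (small 7)
        (run-load refl refl z′<
        (run-add refl refl refl (≤-<-trans (m≤m+n _ _) index<) (≤-<-trans (m≤n+m _ (mem (z′ + 7))) index<)
        (run-load refl refl index<
        (runs refl)))))))))))))))))))))))))))))))))))
        where
        small : ∀ v {v≤8 : True (v ≤? 8)} → v < s
        small v {v≤8} = ≤-<-trans (toWitness v≤8) 8<
        offset : ∀ {a o} → a + o < s → ∀ {o′} → o′ ≤ o → a + o′ < s
        offset {a} h o′≤o = ≤-<-trans (+-monoʳ-≤ a o′≤o) h
        x8< : x * 8 < s
        x8< = ≤-<-trans (m≤m+n _ 1) x<
        y8< : y * 8 < s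
        y8< = ≤-<-trans (m≤m+n _ 6) y<
        z₀< : z < s
        z₀< = ≤-<-trans (m≤m+n _ 6) z<
        z₀′< : z′ < s
        z₀′< = ≤-<-trans (m≤m+n _ 7) z′<
        yz< : mem (y * 8 + 6) + mem (z + 6) < s
        yz< = ≤-<-trans (m≤m+n _ _) total<

-- The data structure

/-block : ∀ a {d r} .{{_ : NonZero d}} → r < d → (a * d + r) / d ≡ a
/-block a {d} {r} r<d = begin
  (a * d + r) / d      ≡⟨ cong (_/ d) (+-comm (a * d) r) ⟩
  (r + a * d) / d      ≡⟨ +-distrib-/-∣ʳ r (n∣m*n a) ⟩
  r / d + a * d / d    ≡⟨ cong₂ _+_ (m<n⇒m/n≡0 r<d) (m*n/n≡m a d) ⟩
  a                    ∎
  where open ≡-Reasoning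

%-block : ∀ a {d r} .{{_ : NonZero d}} → r < d → (a * d + r) % d ≡ r
%-block a {d} {r} r<d = trans (cong (_% d) (+-comm (a * d) r))
  (trans ([m+kn]%n≡m%n r a d) (m<n⇒m%n≡m r<d))

block-< : ∀ {a b d r} → a < b → r < d → a * d + r < b * d
block-< {a} {b} {d} {r} a<b r<d = <-≤-trans (+-monoʳ-< (a * d) r<d)
  (subst (_≤ b * d) (+-comm d (a * d)) (*-monoˡ-≤ d a<b))

shift-block : ∀ a b f → a * 8 + f + b * 8 ≡ (a + b) * 8 + f
shift-block = solve 3 (λ a b f → a :* con 8 :+ f :+ b :* con 8 := (a :+ b) :* con 8 :+ f) refl
  where open +-*-Solver

n<2^suc⌊log₂n⌋ : ∀ n → n < 2 ^ suc ⌊log₂ n ⌋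
n<2^suc⌊log₂n⌋ n = ≰⇒> λ 2^≤n → <-irrefl refl
  (subst (_≤ ⌊log₂ n ⌋) (⌊log₂[2^n]⌋≡n (suc ⌊log₂ n ⌋)) (⌊log₂⌋-mono-≤ 2^≤n))

-- There are `suc n` blocks because labels run from 1 to `n`, while the codes of pairs start at 0.
words : ℕ → ℕ
words n = suc n * 8

-- Of four factors `2 ^ L`, one exceeds `n` and the other three cover the 8 words of a block, as `L`
-- is at least 1. Hence the word factor 4.
words≤2^wordSize : ∀ n → words n ≤ 2 ^ wordSize 4 n
words≤2^wordSize n = subst (words n ≤_) (sym (^-distribˡ-+-* 2 L (3 * L)))
  (*-mono-≤ (n<2^suc⌊log₂n⌋ n) (^-monoʳ-≤ 2 {3} {3 * L} (*-monoʳ-≤ 3 (s≤s z≤n))))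
  where
  L : ℕ
  L = suc ⌊log₂ n ⌋

module Layout {n} (G : FiniteGroup n) (C : GroupTheory.Coordinates G) where
  open GroupTheory G
  open Coordinates C

  element-at : ℕ → Fin n
  element-at zero = ε
  element-at (suc j) with j <? n
  ... | yes j<n = fromℕ< j<n
  ... | no _    = ε

  element-at-label : ∀ x → element-at (label x) ≡ x
  element-at-label x with toℕ x <? n
  ... | yes x<n = toℕ-injective (toℕ-fromℕ< x<n)
  ... | no x≮n  = contradiction (toℕ<n x) x≮n

  -- Memory consists of blocks of 8 words. In the block of (the label of) an
  -- element x, words 0, 1, 2, 6, 7 contain coordinates of x, mostly as partial
  -- addresses; word 0 of block 0, which is not a label, contains m. Words 3, 4, 5
  -- of block e contain the products c ↑ u ∙ t j, t i ∙ t j and t i ∙ c ↑ u, where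
  -- e encodes the respective pair, the first two as block addresses.
  content : ℕ → ℕ → ℕ
  content b 0 = if b ≡ᵇ 0 then m else i (element-at b) * k * 8 + 4
  content b 1 = u (element-at b) * k * 8 + 3
  content b 2 = i (element-at b) * 8
  content b 3 = label (c ↑ (b / k) ∙ t (b % k)) * 8
  content b 4 = label (t (b / k) ∙ t (b % k)) * 8
  content b 5 = label (t (b / m) ∙ c ↑ (b % m))
  content b 6 = u (element-at b)
  content b _ = i (element-at b) * m * 8 + 5

  mem : ℕ → ℕ
  mem a = content (a / 8) (a % 8)

  mem-block : ∀ b {f} → f < 8 → mem (b * 8 + f) ≡ content b f
  mem-block b f<8 = cong₂ content (/-block b f<8) (%-block b f<8)

  module _ (x y : Fin n) where
    open Execution (wordSize 4 n) (words n) (words≤2^wordSize n) mem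

    private
      X Y : ℕ
      X = label x
      Y = label y

    address< : ∀ {b f} → b ≤ n → f < 8 → b * 8 + f < words n
    address< b≤n f<8 = block-< (s≤s b≤n) f<8

    label≤n : ∀ w → label w ≤ n
    label≤n = toℕ<n

    mem-1 : mem (X * 8 + 1) ≡ u x * k * 8 + 3
    mem-1 = trans (mem-block X (s≤s (s≤s z≤n))) (cong (λ v → u v * k * 8 + 3) (element-at-label x))

    mem-2 : ∀ w → mem (label w * 8 + 2) ≡ i w * 8
    mem-2 w = trans (mem-block (label w) (s≤s (s≤s (s≤s z≤n)))) (cong (λ v → i v * 8) (element-at-label w))

    mem-0 : mem (X * 8) ≡ i x * k * 8 + 4
    mem-0 = trans (cong mem (sym (+-identityʳ (X * 8)))) (trans (mem-block X (s≤s z≤n))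
      (cong (λ v → i v * k * 8 + 4) (element-at-label x)))

    mem-6 : ∀ w → mem (label w * 8 + 6) ≡ u w
    mem-6 w = trans (mem-block (label w) (<ᵇ⇒< 6 8 _)) (cong u (element-at-label w))

    mem-7 : ∀ w → mem (label w * 8 + 7) ≡ i w * m * 8 + 5
    mem-7 w = trans (mem-block (label w) (<ᵇ⇒< 7 8 _)) (cong (λ v → i v * m * 8 + 5) (element-at-label w))

    -- Adding two partial addresses forms the block number of the pair `(u x , i y)`; the offset 3
    -- of the table is already contained in the first one.
    address-3 : mem (X * 8 + 1) + mem (Y * 8 + 2) ≡ (u x * k + i y) * 8 + 3
    address-3 = trans (cong₂ _+_ mem-1 (mem-2 y)) (shift-block (u x * k) (i y) 3)

    z≡ : z X Y ≡ label (slide x y) * 8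
    z≡ = trans (cong mem address-3) (trans (mem-block (u x * k + i y) (<ᵇ⇒< 3 8 _))
      (cong₂ (λ a b → label (c ↑ a ∙ t b) * 8) (/-block (u x) (i<k y)) (%-block (u x) (i<k y))))

    address-4 : mem (X * 8) + mem (z X Y + 2) ≡ (i x * k + i (slide x y)) * 8 + 4
    address-4 = trans (cong₂ _+_ mem-0 (trans (cong (λ a → mem (a + 2)) z≡) (mem-2 (slide x y))))
      (shift-block (i x * k) (i (slide x y)) 4)

    z′≡ : z′ X Y ≡ label (top x y) * 8
    z′≡ = trans (cong mem address-4) (trans (mem-block (i x * k + i (slide x y)) (<ᵇ⇒< 4 8 _))
      (cong₂ (λ a b → label (t a ∙ t b) * 8) (/-block (i x) (i<k (slide x y))) (%-block (i x) (i<k (slide x y)))))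

    total≡ : total X Y ≡ exponent-sum x y
    total≡ = cong₂ _+_ (cong₂ _+_ (mem-6 y) (trans (cong (λ a → mem (a + 6)) z≡) (mem-6 (slide x y))))
      (trans (cong (λ a → mem (a + 6)) z′≡) (mem-6 (top x y)))

    reduced : ℕ
    reduced = exponent-sum x y % m

    reduced<m : reduced < m
    reduced<m = m%n<n (exponent-sum x y) m

    index≡ : index X Y ≡ (i (top x y) * m + reduced) * 8 + 5
    index≡ = trans (cong₂ (λ a b → a + b % m * 8) (trans (cong (λ a → mem (a + 7)) z′≡) (mem-7 (top x y))) total≡)
      (shift-block (i (top x y) * m) reduced 5)

    mem-index≡ : mem (index X Y) ≡ label (x ∙ y)
    mem-index≡ = trans (cong mem index≡) (trans (mem-block (i (top x y) * m + reduced) (<ᵇ⇒< 5 8 _))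
      (trans (cong₂ (λ a b → label (t a ∙ c ↑ b)) (/-block (i (top x y)) reduced<m) (%-block (i (top x y)) reduced<m))
        (cong label (∙-coordinates x y))))

    m≤n : m ≤ n
    m≤n = subst (m ≤_) k*m≡n (m≤n*m m k)

    u≤n : ∀ w → u w ≤ n
    u≤n w = ≤-trans (<⇒≤ (u<m w)) m≤n

    exponent-sum< : exponent-sum x y < words n
    -- Three exponents of at most `n` each, and `3 * n < 8 * suc n`: the sum fits into a word, so a
    -- single reduction modulo `m` at the end is enough.
    exponent-sum< = ≤-<-trans (+-mono-≤ (+-mono-≤ (u≤n y) (u≤n (slide x y))) (u≤n (top x y)))
      (subst (_< words n) (solve 1 (λ a → a :* con 3 := a :+ a :+ a) refl n)
        (*-mono-< {n} {suc n} {3} {8} (n<1+n n) (<ᵇ⇒< 3 8 _)))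
      where open +-*-Solver

    query-result : ∃[ R ] (Machine.run (wordSize 4 n) 35 multiply
        (Machine.state 0 (Machine.word (wordSize 4 n) X ∷ Machine.word (wordSize 4 n) Y ∷ replicate 5 (Machine.word (wordSize 4 n) 0)) M)
      ≡ just (Machine.state 34 (Machine.word (wordSize 4 n) (label (x ∙ y)) ∷ R) M))
    query-result =
      let R , eqn = run-multiply X Y 8< (address< (label≤n x) (<ᵇ⇒< 1 8 _)) (address< (label≤n y) (<ᵇ⇒< 6 8 _))
            (subst (_< words n) (sym address-3) (address< (<⇒≤ (subst (u x * k + i y <_) m*k≡n (block-< (u<m x) (i<k y)))) (<ᵇ⇒< 3 8 _)))
            (subst (λ a → a + 6 < words n) (sym z≡) (address< (label≤n (slide x y)) (<ᵇ⇒< 6 8 _)))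
            -- The code of a pair of representatives is below `k * k`. Here `k ≤ m` is used, to
            -- bound this by `k * m`, which is `n`.
            (subst (_< words n) (sym address-4)
              (address< (<⇒≤ (<-≤-trans (block-< (i<k x) (i<k (slide x y)))
                (subst (k * k ≤_) k*m≡n (*-monoʳ-≤ k k≤m)))) (<ᵇ⇒< 4 8 _)))
            (subst (λ a → a + 7 < words n) (sym z′≡) (address< (label≤n (top x y)) (<ᵇ⇒< 7 8 _)))
            (subst (_< words n) (sym total≡) exponent-sum<)
            (≤-<-trans m≤n (<-≤-trans (n<1+n n) (m≤m*n (suc n) 8)))
            (subst (_< words n) (sym index≡)
              (address< (<⇒≤ (subst (i (top x y) * m + reduced <_) k*m≡n (block-< (i<k (top x y)) reduced<m))) (<ᵇ⇒< 5 8 _)))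
      in R , trans eqn (cong (λ a → just (Machine.state 34 (Machine.word (wordSize 4 n) a ∷ R) M)) mem-index≡)
      where
      m*k≡n : m * k ≡ n
      m*k≡n = trans (*-comm m k) k*m≡n
      8< : 8 < words n
      8< = subst (_< words n) (*-identityˡ 8) (*-monoˡ-< 8 (s≤s 0<n))

    product-word : toℕ (Machine.word (wordSize 4 n) (label (x ∙ y))) ≡ label (x ∙ y)
    product-word = toℕ-word (≤-<-trans (label≤n (x ∙ y)) (<-≤-trans (n<1+n n) (m≤m*n (suc n) 8)))

representation : Representation IsZGroup
representation = record
  { wordFactor = 4
  ; extraRegisters = 5
  ; program = multiply
  ; space = λ {n} _ _ → words n
  ; preprocess = λ {n} G Z → tabulate λ a →
      Machine.word (wordSize 4 n) (Layout.mem G (GroupTheory.group-coordinates G Z) (toℕ a))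
  }

theorem2 : Σ[ R ∈ Representation IsZGroup ] ∃[ s ] ∃[ t ]
    (∀ {n : ℕ} (G : FiniteGroup n) (Z : IsZGroup G) →
    Representation.space R G Z ≤ s * n × Representation.MultipliesWithin R t G Z)
-- `16` comes from `8 * suc n ≤ 16 * n`, as a group has at least one element.
theorem2 = representation , 16 , 35 , λ {n} G Z →
  words≤16n (GroupTheory.0<n G) , λ x y →
    let R , eqn = Layout.query-result G (GroupTheory.group-coordinates G Z) x y
    -- The program contains no `store`, so the final memory is the initial one.
    in _ , eqn , Layout.product-word G (GroupTheory.group-coordinates G Z) x y , refl
  where
  words≤16n : ∀ {n} → 0 < n → words n ≤ 16 * n
  words≤16n {n} 0<n = subst (words n ≤_) (solve 1 (λ a → (a :+ a) :* con 8 := con 16 :* a) refl n)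
    (*-monoˡ-≤ 8 (+-monoˡ-≤ n 0<n))
    where open +-*-Solver
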